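{- Let $G=(V,E)$ be a finite graph. Then for every $u,v\in V$, every $t\subseteq V$, and every $p$ with $1-2^{ -|E|/2-2}\leqslant p<1$, \[ \mathbb{P}^{\mathrm{bb}}_p\big((u,0)\leftrightarrow (v,0)\mid T=t\big) \;\geqslant\; \mathbb{P}^{\mathrm{bb}}_p\big((u,0)\leftrightarrow (v,1)\mid T=t\big), \] with strict inequality if and only if $u$ and $v$ are connected in the subgraph of $G$ induced by $V\setminus t$ (in particular this requires $u,v\notin t$).
   Context: Graphs are allowed to contain self-loops and multiple edges. The bunkbed graph of $G=(V,E)$ is the Cartesian product $G\times K_2$: its vertex set is $V\times\{0,1\}$; for every edge $e$ of $G$ with endpoints $x,y$ there are two "horizontal" edges, one joining $(x,0)$ to $(y,0)$ and one joining $(x,1)$ to $(y,1)$; and for every $w\in V$ there is one "vertical" edge joining $(w,0)$ and $(w,1)$. $\mathbb{P}^{\mathrm{bb}}_p$ denotes the law of Bernoulli bond percolation with parameter $p$ on $G\times K_2$: each edge is independently open with probability $p$ and closed otherwise, and $a\leftrightarrow b$ denotes the event that $a$ and $b$ are joined by a path of open edges. $T\subseteq V$ denotes the random set of vertices $w$ whose vertical edge $\{(w,0),(w,1)\}$ is open (for $0<p<1$ every $t\subseteq V$ has positive probability).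
   Formalization: The percolation parameter p is restricted to rational numbers; the condition p ≥ 1-2^{ -|E|/2-2} is written in the equivalent squared form (1-p)²·2^{|E|+4} ≤ 1. -}

module Defs where

open import Data.Bool using (Bool; true; false; _∧_; _∨_; not; if_then_else_)
open import Data.Nat using (ℕ; zero; suc)
open import Data.Fin using (Fin)
open import Data.Fin.Subset using (Subset)
open import Data.List using (List; []; _∷_; concatMap; map; foldr; allFin; cartesianProduct)
open import Data.Bool.ListAction using (any)
open import Data.Vec using (Vec; []; _∷_; lookup)
open import Data.Product using (_×_; _,_; proj₁; proj₂)
open import Data.Rational using (ℚ; 0ℚ; 1ℚ; _+_; _*_; _-_; _÷_; ≢-nonZero)
open import Data.Rational.Properties using (_≟_)
open import Relation.Nullary using (yes; no; does)
import Data.Fin as F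
import Data.Bool as B

-- A finite multigraph G = (V , E) with V = Fin n and E = Fin m;
-- edge e has endpoints ends e (self-loops and parallel edges allowed).

record Graph : Set where
  field
    n    : ℕ
    m    : ℕ
    ends : Fin m → Fin n × Fin n
open Graph public

_==ᶠ_ : ∀ {k} → Fin k → Fin k → Bool
x ==ᶠ y = does (x F.≟ y)

joins : (G : Graph) → Fin (m G) → Fin (n G) → Fin (n G) → Bool
joins G e x y =
  ((proj₁ (ends G e) ==ᶠ x) ∧ (proj₂ (ends G e) ==ᶠ y)) ∨
  ((proj₁ (ends G e) ==ᶠ y) ∧ (proj₂ (ends G e) ==ᶠ x))

reachLe : {A : Set} → List A → (A → A → Bool) → (A → A → Bool) → ℕ → A → A → Bool
reachLe vs eq adj zero    a b = eq a b
reachLe vs eq adj (suc k) a b =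
  reachLe vs eq adj k a b ∨ any (λ c → reachLe vs eq adj k a c ∧ adj c b) vs

-- Bunkbed graph G × K₂.  Vertices: Fin n × Bool (false = layer 0,
-- true = layer 1).  A configuration assigns open/closed (true/false)
-- to every edge of G × K₂: the horizontal copies in layer 0 and 1,
-- and the vertical edge at every vertex.

BVertex : Graph → Set
BVertex G = Fin (n G) × Bool

record Config (G : Graph) : Set where
  constructor config
  field
    hor0 : Vec Bool (m G)
    hor1 : Vec Bool (m G)
    vert : Vec Bool (n G)
open Config public

horLayer : {G : Graph} → Config G → Bool → Vec Bool (m G)
horLayer ω false = hor0 ω
horLayer ω true  = hor1 ω

bvertices : (G : Graph) → List (BVertex G)
bvertices G = cartesianProduct (allFin (n G)) (false ∷ true ∷ [])

bEq : (G : Graph) → BVertex G → BVertex G → Bool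
bEq G (x , i) (y , j) = (x ==ᶠ y) ∧ does (i B.≟ j)

openAdj : (G : Graph) → Config G → BVertex G → BVertex G → Bool
openAdj G ω (x , i) (y , j) =
  (does (i B.≟ j) ∧ any (λ e → lookup (horLayer ω i) e ∧ joins G e x y) (allFin (m G)))
  ∨ ((x ==ᶠ y) ∧ not (does (i B.≟ j)) ∧ lookup (vert ω) x)

-- a ↔ b : joined by an open path (walks of length ≤ |V(G×K₂)| = 2n suffice)
connected : (G : Graph) → Config G → BVertex G → BVertex G → Bool
connected G ω = reachLe (bvertices G) (bEq G) (openAdj G ω) (n G Data.Nat.+ n G)

allVecs : (k : ℕ) → List (Vec Bool k)
allVecs zero    = [] ∷ []
allVecs (suc k) = concatMap (λ v → (false ∷ v) ∷ (true ∷ v) ∷ []) (allVecs k)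

allConfigs : (G : Graph) → List (Config G)
allConfigs G =
  concatMap (λ h0 → concatMap (λ h1 → map (config h0 h1) (allVecs (n G)))
                                (allVecs (m G)))
            (allVecs (m G))

vecWeight : ℚ → ∀ {k} → Vec Bool k → ℚ
vecWeight p []          = 1ℚ
vecWeight p (true  ∷ v) = p * vecWeight p v
vecWeight p (false ∷ v) = (1ℚ - p) * vecWeight p v

weight : ℚ → {G : Graph} → Config G → ℚ
weight p ω = vecWeight p (hor0 ω) * vecWeight p (hor1 ω) * vecWeight p (vert ω)

Event : Graph → Set
Event G = Config G → Bool

Pbb : (G : Graph) → ℚ → Event G → ℚ
Pbb G p A = foldr (λ ω s → (if A ω then weight p ω else 0ℚ) + s) 0ℚ (allConfigs G)

-- P^bb_p(A | B) = P(A ∩ B) / P(B)   (set to 0 when P(B) = 0)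
condP : (G : Graph) → ℚ → Event G → Event G → ℚ
condP G p A B with Pbb G p B ≟ 0ℚ
... | yes _  = 0ℚ
... | no  ne = _÷_ (Pbb G p (λ ω → A ω ∧ B ω)) (Pbb G p B) {{≢-nonZero ne}}

conn : (G : Graph) → BVertex G → BVertex G → Event G
conn G a b ω = connected G ω a b

-- the event  T = t,  where T is the set of w with open vertical edge
vecEq : ∀ {k} → Vec Bool k → Vec Bool k → Bool
vecEq []       []       = true
vecEq (a ∷ v) (b ∷ w)  = does (a B.≟ b) ∧ vecEq v w

TEq : (G : Graph) → Subset (n G) → Event G
TEq G t ω = vecEq (vert ω) t

outside : {k : ℕ} → Subset k → Fin k → Bool
outside t x = not (lookup t x)

inducedAdj : (G : Graph) → Subset (n G) → Fin (n G) → Fin (n G) → Bool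
inducedAdj G t x y =
  outside t x ∧ outside t y ∧ any (λ e → joins G e x y) (allFin (m G))

connectedInduced : (G : Graph) → Subset (n G) → Fin (n G) → Fin (n G) → Bool
connectedInduced G t u v =
  outside t u ∧ outside t v ∧
  reachLe (allFin (n G)) _==ᶠ_ (inducedAdj G t) (n G) u v

{-# OPTIONS --safe #-}
module Submission where

-- Given T = t, a configuration is a pair of edge sets, one for each layer. Call an edge double if
-- both of its copies are open. Both copies of a vertex joined to t by double edges are connected,
-- so let C be the component of v among the other vertices, using the edges with at least one open
-- copy. Exchanging the layers on all edges that touch C preserves the measure, and it exchanges the
-- layers of C in every cluster. Let "same" be the event that (u,0) is connected to (v,0) but not to
-- (v,1), and "cross" the event with the two targets interchanged. The exchange injects cross into
-- same, except for the configurations in which u lies in C and (u,1), (v,1) are not connected.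
-- In those no boundary edge of K = C is double, and both layers have an open edge within K whose
-- other copy is closed ("mixed"): otherwise all open edges within K would have copies in a common
-- layer. Comparing, for each K, with the event that all boundary edges of K are closed in layer 0
-- and all edges within K are double ("sealed"), the boundary costs at most a factor 2 per edge,
-- while the two closed copies within K cost q² with q = 1 - p. This is where q² 2^|E| enters. The
-- sealed events are disjoint for different K and lie in same, where u and v are joined by double
-- edges, and the exchange does not map cross into these configurations.

open import Defs
open import Data.Bool using (Bool; true; false; T; _∧_; _∨_; not; if_then_else_)
import Data.Bool as B
open import Data.Bool.ListAction using (any)
open import Data.Bool.Properties using (T-∧; T-∨; T?; T-≡; ∨-comm; ∧-comm; not-involutive)
open import Data.Empty using (⊥; ⊥-elim)
open import Data.Fin using (Fin)
import Data.Fin as F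
import Data.Fin.Properties as Fₚ
open import Data.Fin.Subset using (Subset)
import Data.Integer as ℤ
import Data.Integer.Properties as ℤₚ
open import Data.List using (List; []; _∷_; length; filterᵇ; allFin; cartesianProduct; foldr; concatMap; map; _++_)
import Data.List.Properties as Listₚ
open import Data.List.Membership.Propositional using (_∈_; lose; find)
open import Data.List.Membership.Propositional.Properties using (∈-allFin; ∈-cartesianProduct⁺)
open import Data.List.Relation.Unary.Any using (here; there)
import Data.List.Relation.Unary.Any as Any
open import Data.List.Relation.Unary.Any.Properties using (any⁺; any⁻)
open import Data.Nat as ℕ using (ℕ; zero; suc)
import Data.Nat.Properties as ℕₚ
open import Data.Product using (_×_; _,_; proj₁; proj₂; ∃; ∃₂)
open import Data.Rational using (ℚ; 0ℚ; 1ℚ; _+_; _*_; _-_; -_; _/_; 1/_; _≤_; _<_; nonNegative; positive; toℚᵘ; ≢-nonZero)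
open import Data.Rational.Properties
open import Data.Rational.Solver using (module +-*-Solver)
import Data.Rational.Unnormalised as ℚᵘ
import Data.Rational.Unnormalised.Properties as ℚᵘₚ
open import Data.Sum using (_⊎_; inj₁; inj₂; [_,_]′; swap)
open import Data.Vec using (Vec; []; _∷_; lookup; zipWith; tabulate)
open import Data.Vec.Properties using (lookup-zipWith; lookup∘tabulate; tabulate∘lookup; tabulate-cong)
open import Function using (_∘_)
open import Function.Bundles using (_⇔_; mk⇔; Equivalence)
open import Relation.Binary.Construct.Closure.ReflexiveTransitive
  using (Star; ε; _◅_; _◅◅_; gmap; reverse; kleisliStar) renaming (map to mapStar)
open import Relation.Binary.PropositionalEquality hiding (J)
open import Relation.Nullary using (¬_; Dec; yes; no; does)
open import Relation.Nullary.Decidable using (map′; ¬?; _×-dec_; _→-dec_; from-yes; decidable-stable)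
open +-*-Solver using (solve; con; _:+_; _:*_; _:-_; _:=_)

-- Reachability by walks of bounded length

filterᵇ-mono : {A : Set} (f g : A → Bool) → (∀ x → T (f x) → T (g x)) →
  ∀ xs → length (filterᵇ f xs) ℕ.≤ length (filterᵇ g xs)
filterᵇ-mono f g f⊆g [] = ℕ.z≤n
filterᵇ-mono f g f⊆g (x ∷ xs) with f x | g x | f⊆g x
... | false | false | _ = filterᵇ-mono f g f⊆g xs
... | false | true  | _ = ℕₚ.m≤n⇒m≤1+n (filterᵇ-mono f g f⊆g xs)
... | true  | true  | _ = ℕ.s≤s (filterᵇ-mono f g f⊆g xs)
... | true  | false | h = ⊥-elim (h _)

filterᵇ-strict : {A : Set} (f g : A → Bool) → (∀ x → T (f x) → T (g x)) →
  ∀ {x} xs → x ∈ xs → T (g x) → ¬ T (f x) → length (filterᵇ f xs) ℕ.< length (filterᵇ g xs)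
filterᵇ-strict f g f⊆g (x ∷ xs) (here refl) gx ¬fx with f x | g x
... | false | true = ℕ.s≤s (filterᵇ-mono f g f⊆g xs)
... | true  | _    = ⊥-elim (¬fx _)
filterᵇ-strict f g f⊆g (y ∷ xs) (there x∈) gx ¬fx with f y | g y | f⊆g y
... | false | false | _ = filterᵇ-strict f g f⊆g xs x∈ gx ¬fx
... | false | true  | _ = ℕₚ.m≤n⇒m≤1+n (filterᵇ-strict f g f⊆g xs x∈ gx ¬fx)
... | true  | true  | _ = ℕ.s≤s (filterᵇ-strict f g f⊆g xs x∈ gx ¬fx)
... | true  | false | h = ⊥-elim (h _)

T-not⁻ : ∀ {b} → T (not b) → ¬ T b
T-not⁻ {false} _ ()

T-not⁺ : ∀ {b} → ¬ T b → T (not b)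
T-not⁺ {false} _ = _
T-not⁺ {true} h = h _

T-any : {A : Set} (f : A → Bool) {xs : List A} → (∀ a → a ∈ xs) → T (any f xs) ⇔ ∃ λ a → T (f a)
T-any f {xs} complete = mk⇔
  (λ h → let (a , _ , fa) = find (any⁻ f xs h) in a , fa)
  (λ (a , fa) → any⁺ f (lose (complete a) fa))

-- A reach set that grows at every step up to k has more than k elements, so the sets are
-- stationary from step |vs| on.
module ReachLe {A : Set} (vs : List A) (complete : ∀ a → a ∈ vs)
  (eq : A → A → Bool) (T-eq : ∀ {a b} → T (eq a b) ⇔ a ≡ b) (adj : A → A → Bool) where

  private
    R : ℕ → A → A → Bool
    R = reachLe vs eq adj

    Adj : A → A → Set
    Adj a b = T (adj a b)

    R-suc : ∀ k {a b} → T (R (suc k) a b) ⇔ (T (R k a b) ⊎ ∃ λ c → T (R k a c) × Adj c b)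
    R-suc k {a} {b} = mk⇔
      (λ h → case (Equivalence.to T-∨ h))
      λ { (inj₁ h) → Equivalence.from T-∨ (inj₁ h)
        ; (inj₂ (c , h)) → Equivalence.from (T-∨ {R k a b})
            (inj₂ (Equivalence.from (T-any _ complete) (c , Equivalence.from T-∧ h))) }
      where
      case : T (R k a b) ⊎ T (any (λ c → R k a c ∧ adj c b) vs) →
             T (R k a b) ⊎ ∃ λ c → T (R k a c) × Adj c b
      case (inj₁ h) = inj₁ h
      case (inj₂ h) with Equivalence.to (T-any _ complete) h
      ... | c , w = inj₂ (c , Equivalence.to T-∧ w)

    R-mono : ∀ k {a b} → T (R k a b) → T (R (suc k) a b)
    R-mono k h = Equivalence.from (R-suc k) (inj₁ h)

    R-refl : ∀ k {a} → T (R k a a)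
    R-refl zero = Equivalence.from T-eq refl
    R-refl (suc k) = R-mono k (R-refl k)

    Stationary : ℕ → A → Set
    Stationary k a = ∀ b → T (R (suc k) a b) → T (R k a b)

    -- Each reach set is computed from the previous one, so once a step adds nothing, no later step
    -- does.
    stationary-suc : ∀ k {a} → Stationary k a → Stationary (suc k) a
    stationary-suc k st b h with Equivalence.to (R-suc (suc k)) h
    ... | inj₁ h′ = h′
    ... | inj₂ (c , h′ , e) = Equivalence.from (R-suc k) (inj₂ (c , st c h′ , e))

    size : ℕ → A → ℕ
    size k a = length (filterᵇ (R k a) vs)

    grow : ∀ k a → Stationary k a ⊎ suc k ℕ.≤ size k a
    grow zero a = inj₂ (ℕₚ.≤-trans (ℕ.s≤s ℕ.z≤n)
      -- Comparison with the empty filter: level 0 contains `a`, so it has at least one element.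
      (filterᵇ-strict (λ _ → false) (R 0 a) (λ _ ()) vs (complete a) (R-refl 0) λ ()))
    grow (suc k) a with grow k a
    ... | inj₁ st = inj₁ (stationary-suc k st)
    ... | inj₂ big with Any.any? (λ d → T? (R (suc k) a d ∧ not (R k a d))) vs
    ...   | yes w with find w
    ...     | d , d∈ , h = inj₂ (ℕₚ.≤-trans (ℕ.s≤s big)
                (filterᵇ-strict (R k a) (R (suc k) a) (λ x → R-mono k) vs d∈
                  (proj₁ (Equivalence.to T-∧ h))
                  (T-not⁻ (proj₂ (Equivalence.to (T-∧ {R (suc k) a d}) h)))))
    grow (suc k) a | inj₂ big | no ¬w = inj₁ (stationary-suc k st)
      where
      st : Stationary k a
      st b h with T? (R k a b)
      ... | yes r = r
      ... | no ¬r = ⊥-elim (¬w (lose (complete b) (Equivalence.from T-∧ (h , T-not⁺ ¬r))))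

    stationary-closed : ∀ k {a b c} → Stationary k a → T (R k a b) → Star Adj b c → T (R k a c)
    stationary-closed k st r ε = r
    stationary-closed k st r (e ◅ es) =
      stationary-closed k st (st _ (Equivalence.from (R-suc k) (inj₂ (_ , r , e)))) es

    sound : ∀ k {a b} → T (R k a b) → Star Adj a b
    sound zero h with Equivalence.to T-eq h
    ... | refl = ε
    sound (suc k) h with Equivalence.to (R-suc k) h
    ... | inj₁ h′ = sound k h′
    ... | inj₂ (c , h′ , e) = sound k h′ ◅◅ e ◅ ε

  T-reachLe : ∀ {k a b} → length vs ℕ.≤ k → T (reachLe vs eq adj k a b) ⇔ Star Adj a b
  T-reachLe {k} {a} {b} len≤k = mk⇔ (sound k) complete′
    where
    complete′ : Star Adj a b → T (R k a b)
    complete′ s with grow k a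
    ... | inj₁ st = stationary-closed k st (R-refl k) s
    -- A set still growing at step `k` has more than `k` elements, but it is filtered from a list of
    -- length at most `k`.
    ... | inj₂ big = ⊥-elim (ℕₚ.<-irrefl refl
            (ℕₚ.≤-trans big (ℕₚ.≤-trans (Listₚ.length-filter (T? ∘ R k a) vs) len≤k)))

T-does : {P : Set} (P? : Dec P) → T (does P?) ⇔ P
T-does (yes p) = mk⇔ (λ _ → p) (λ _ → _)
T-does (no ¬p) = mk⇔ (λ ()) ¬p

T-==ᶠ : ∀ {k} {x y : Fin k} → T (x ==ᶠ y) ⇔ x ≡ y
T-==ᶠ {x = x} {y} = T-does (x F.≟ y)

T-==ᶠ-refl : ∀ {k} (x : Fin k) → T (x ==ᶠ x)
T-==ᶠ-refl x = Equivalence.from (T-==ᶠ {x = x} {x}) refl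

-- Swaps the entries of two vectors in the positions marked by the first argument;
-- `mix g a b` is the first component of the result and `mix g b a` the second.
mix : ∀ {m} → Vec Bool m → Vec Bool m → Vec Bool m → Vec Bool m
mix []      []      []      = []
mix (g ∷ gs) (a ∷ as) (b ∷ bs) = (if g then b else a) ∷ mix gs as bs

lookup-mix : ∀ {m} (g a b : Vec Bool m) e →
  lookup (mix g a b) e ≡ (if lookup g e then lookup b e else lookup a e)
lookup-mix (g ∷ gs) (a ∷ as) (b ∷ bs) F.zero = refl
lookup-mix (g ∷ gs) (a ∷ as) (b ∷ bs) (F.suc e) = lookup-mix gs as bs e

mix-involutive : ∀ {m} (g a b : Vec Bool m) → mix g (mix g a b) (mix g b a) ≡ a
mix-involutive [] [] [] = refl
mix-involutive (true  ∷ gs) (a ∷ as) (b ∷ bs) = cong (a ∷_) (mix-involutive gs as bs)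
mix-involutive (false ∷ gs) (a ∷ as) (b ∷ bs) = cong (a ∷_) (mix-involutive gs as bs)

zipWith-mix : ∀ {m} {f : Bool → Bool → Bool} → (∀ a b → f a b ≡ f b a) →
  (g a b : Vec Bool m) → zipWith f (mix g a b) (mix g b a) ≡ zipWith f a b
zipWith-mix f-comm [] [] [] = refl
zipWith-mix f-comm (true  ∷ gs) (a ∷ as) (b ∷ bs) = cong₂ _∷_ (f-comm b a) (zipWith-mix f-comm gs as bs)
zipWith-mix f-comm (false ∷ gs) (a ∷ as) (b ∷ bs) = cong (_ ∷_) (zipWith-mix f-comm gs as bs)

length-×-pair : {A B : Set} (xs : List A) {y z : B} →
  length (cartesianProduct xs (y ∷ z ∷ [])) ≡ length xs ℕ.* 2
length-×-pair []       = refl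
length-×-pair (x ∷ xs) = cong (ℕ.suc ∘ ℕ.suc) (length-×-pair xs)

-- Configurations and the mirror map

module Bunkbed (G : Graph) where

  V : Set
  V = Fin (n G)

  Joins : Fin (m G) → V → V → Set
  Joins e x y = T (joins G e x y)

  joins-ends : ∀ {e x y} → Joins e x y → ends G e ≡ (x , y) ⊎ ends G e ≡ (y , x)
  joins-ends {e} {x} {y} j with Equivalence.to T-∨ j
  ... | inj₁ h = let (p , q) = Equivalence.to T-∧ h in
                 inj₁ (cong₂ _,_ (Equivalence.to T-==ᶠ p) (Equivalence.to T-==ᶠ q))
  ... | inj₂ h = let (p , q) = Equivalence.to T-∧ h in
                 inj₂ (cong₂ _,_ (Equivalence.to T-==ᶠ p) (Equivalence.to T-==ᶠ q))

  ends-joins : ∀ e → Joins e (proj₁ (ends G e)) (proj₂ (ends G e))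
  ends-joins e = Equivalence.from (T-∨ {(x ==ᶠ x) ∧ (y ==ᶠ y)})
    (inj₁ (Equivalence.from (T-∧ {x ==ᶠ x}) (T-==ᶠ-refl x , T-==ᶠ-refl y)))
    where
    x = proj₁ (ends G e)
    y = proj₂ (ends G e)

  joins-sym : ∀ {e x y} → Joins e x y → Joins e y x
  joins-sym {e} {x} {y} = subst T
    (∨-comm ((proj₁ (ends G e) ==ᶠ x) ∧ (proj₂ (ends G e) ==ᶠ y)) _)

  EdgeIn : Vec Bool (m G) → V → V → Set
  EdgeIn s x y = ∃ λ e → T (lookup s e) × Joins e x y

  adjIn : Vec Bool (m G) → V → V → Bool
  adjIn s x y = any (λ e → lookup s e ∧ joins G e x y) (allFin (m G))

  T-adjIn : ∀ s {x y} → T (adjIn s x y) ⇔ EdgeIn s x y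
  T-adjIn s = mk⇔
    (λ h → let (e , w) = Equivalence.to (T-any _ ∈-allFin) h in e , Equivalence.to T-∧ w)
    (λ (e , w) → Equivalence.from (T-any _ ∈-allFin) (e , Equivalence.from T-∧ w))

  reach : (V → V → Bool) → V → V → Bool
  reach adj = reachLe (allFin (n G)) _==ᶠ_ adj (n G)

  T-reach : ∀ adj {x y} → T (reach adj x y) ⇔ Star (λ a b → T (adj a b)) x y
  T-reach adj = ReachLe.T-reachLe (allFin (n G)) ∈-allFin _==ᶠ_ T-==ᶠ adj
    (ℕₚ.≤-reflexive (Listₚ.length-tabulate {n = n G} (λ i → i)))

  data Open (ω : Config G) : BVertex G → BVertex G → Set where
    hor : ∀ {x y} i e → T (lookup (horLayer ω i) e) → Joins e x y → Open ω (x , i) (y , i)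
    ver : ∀ {x} i → T (lookup (vert ω) x) → Open ω (x , i) (x , not i)

  Conn : Config G → BVertex G → BVertex G → Set
  Conn ω = Star (Open ω)

  open-sym : ∀ {ω a b} → Open ω a b → Open ω b a
  open-sym (hor i e o j) = hor i e o (joins-sym j)
  open-sym {ω} (ver {x} i o) =
    subst (λ j → Open ω (x , not i) (x , j)) (not-involutive i) (ver (not i) o)

  conn-sym : ∀ {ω a b} → Conn ω a b → Conn ω b a
  conn-sym = reverse open-sym

  T-openAdj : ∀ {ω a b} → T (openAdj G ω a b) ⇔ Open ω a b
  T-openAdj {ω} {x , i} {y , j} = mk⇔ to from
    where
    diff : ∀ i j → T (not (does (i B.≟ j))) → j ≡ not i
    diff false true  _ = refl
    diff true  false _ = refl
    to : T (openAdj G ω (x , i) (y , j)) → Open ω (x , i) (y , j)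
    to h with Equivalence.to T-∨ h
    ... | inj₁ h₁ with Equivalence.to (T-∧ {does (i B.≟ j)}) h₁
    ...   | i≡j , w with Equivalence.to (T-does (i B.≟ j)) i≡j | Equivalence.to (T-adjIn (horLayer ω i)) w
    ...     | refl | e , o , jn = hor i e o jn
    to h | inj₂ h₂ with Equivalence.to (T-∧ {x ==ᶠ y}) h₂
    ... | x≡y , w with Equivalence.to (T-==ᶠ {x = x} {y}) x≡y | Equivalence.to (T-∧ {not (does (i B.≟ j))}) w
    ...   | refl | i≢j , o with diff i j i≢j
    ...     | refl = ver i o
    differ : ∀ i → T (not (does (i B.≟ not i)))
    differ false = _
    differ true  = _
    from : ∀ {x i y j} → Open ω (x , i) (y , j) → T (openAdj G ω (x , i) (y , j))
    from (hor i e o jn) = Equivalence.from T-∨ (inj₁ (Equivalence.from T-∧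
      (Equivalence.from (T-does (i B.≟ i)) refl , Equivalence.from (T-adjIn (horLayer ω i)) (e , o , jn))))
    from (ver {x} i o) = Equivalence.from
      (T-∨ {does (i B.≟ not i) ∧ adjIn (horLayer ω i) x x})
      (inj₂ (Equivalence.from (T-∧ {x ==ᶠ x}) (T-==ᶠ-refl x ,
        Equivalence.from T-∧ (differ i , o))))

  T-bEq : ∀ {a b} → T (bEq G a b) ⇔ a ≡ b
  T-bEq {x , i} {y , j} = mk⇔
    (λ h → let (p , q) = Equivalence.to T-∧ h in
      cong₂ _,_ (Equivalence.to T-==ᶠ p) (Equivalence.to (T-does (i B.≟ j)) q))
    (λ { refl → Equivalence.from (T-∧ {x ==ᶠ x})
      (T-==ᶠ-refl x , Equivalence.from (T-does (i B.≟ i)) refl) })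

  ∈-bvertices : ∀ a → a ∈ bvertices G
  ∈-bvertices (x , false) = ∈-cartesianProduct⁺ (∈-allFin x) (here refl)
  ∈-bvertices (x , true)  = ∈-cartesianProduct⁺ (∈-allFin x) (there (here refl))

  length-bvertices : length (bvertices G) ≡ n G ℕ.+ n G
  length-bvertices = begin
    length (bvertices G)              ≡⟨ length-×-pair (allFin (n G)) ⟩
    length (allFin (n G)) ℕ.* 2       ≡⟨ cong (ℕ._* 2) (Listₚ.length-tabulate {n = n G} (λ i → i)) ⟩
    n G ℕ.* 2                         ≡⟨ ℕₚ.*-comm (n G) 2 ⟩
    n G ℕ.+ (n G ℕ.+ 0)               ≡⟨ cong (n G ℕ.+_) (ℕₚ.+-identityʳ (n G)) ⟩
    n G ℕ.+ n G                       ∎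
    where open ≡-Reasoning

  T-connected : ∀ {ω a b} → T (connected G ω a b) ⇔ Conn ω a b
  T-connected {ω} = mk⇔
    (λ h → mapStar (Equivalence.to T-openAdj) (Equivalence.to spec h))
    (λ s → Equivalence.from spec (mapStar (Equivalence.from T-openAdj) s))
    where
    spec : ∀ {a b} → T (connected G ω a b) ⇔ Star (λ a b → T (openAdj G ω a b)) a b
    spec = ReachLe.T-reachLe (bvertices G) ∈-bvertices (bEq G) T-bEq (openAdj G ω)
             (ℕₚ.≤-reflexive length-bvertices)

  both either : Config G → Vec Bool (m G)
  both   ω = zipWith _∧_ (hor0 ω) (hor1 ω)
  either ω = zipWith _∨_ (hor0 ω) (hor1 ω)

  both⇔ : ∀ {ω e} → T (lookup (both ω) e) ⇔ (∀ i → T (lookup (horLayer ω i) e))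
  both⇔ {ω} {e} = mk⇔
    (λ h → let (p , q) = Equivalence.to T-∧ (subst T eq h) in λ { false → p ; true → q })
    (λ h → subst T (sym eq) (Equivalence.from T-∧ (h false , h true)))
    where
    eq : lookup (both ω) e ≡ lookup (hor0 ω) e ∧ lookup (hor1 ω) e
    eq = lookup-zipWith _∧_ e (hor0 ω) (hor1 ω)

  either⇔ : ∀ {ω e} → T (lookup (either ω) e) ⇔ ∃ λ i → T (lookup (horLayer ω i) e)
  either⇔ {ω} {e} = mk⇔
    (λ h → [ (false ,_) , (true ,_) ]′ (Equivalence.to T-∨ (subst T eq h)))
    λ { (false , o) → subst T (sym eq) (Equivalence.from T-∨ (inj₁ o))
      ; (true  , o) → subst T (sym eq) (Equivalence.from (T-∨ {lookup (hor0 ω) e}) (inj₂ o)) }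
    where
    eq : lookup (either ω) e ≡ lookup (hor0 ω) e ∨ lookup (hor1 ω) e
    eq = lookup-zipWith _∨_ e (hor0 ω) (hor1 ω)

  -- Both copies of a vertex of the hull are connected in every configuration with d as its doubly
  -- open edges.
  hull : Vec Bool (m G) → Subset (n G) → V → Bool
  hull d t x = any (λ s → lookup t s ∧ reach (adjIn d) s x) (allFin (n G))

  -- The doubly open edges `d` and the edges `s` with an open copy enter as separate vectors, not as
  -- a configuration. Invariance under an exchange of layers is then a congruence in these two
  -- vectors.
  offHull : Vec Bool (m G) → Vec Bool (m G) → Subset (n G) → V → V → Bool
  offHull d s t x y = not (hull d t x) ∧ not (hull d t y) ∧ adjIn s x y

  -- The start vertex always belongs to its component, even when it lies in the hull. This is why
  -- `C-off-hull` and `C-step` assume that `v` is off the hull.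
  component : Vec Bool (m G) → Vec Bool (m G) → Subset (n G) → V → V → Bool
  component d s t = reach (offHull d s t)

  T-hull : ∀ d t {x} → T (hull d t x) ⇔ ∃ λ s → T (lookup t s) × Star (EdgeIn d) s x
  T-hull d t = mk⇔
    (λ h → let (s , w) = Equivalence.to (T-any _ ∈-allFin) h
               (s∈t , r) = Equivalence.to T-∧ w in
           s , s∈t , mapStar (Equivalence.to (T-adjIn d)) (Equivalence.to (T-reach (adjIn d)) r))
    (λ (s , s∈t , r) → Equivalence.from (T-any _ ∈-allFin) (s , Equivalence.from T-∧
           (s∈t , Equivalence.from (T-reach (adjIn d)) (mapStar (Equivalence.from (T-adjIn d)) r))))

  OffHull : Vec Bool (m G) → Vec Bool (m G) → Subset (n G) → V → V → Set
  OffHull d s t x y = ¬ T (hull d t x) × ¬ T (hull d t y) × EdgeIn s x y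

  T-offHull : ∀ d s t {x y} → T (offHull d s t x y) ⇔ OffHull d s t x y
  T-offHull d s t {x} {y} = mk⇔
    (λ h → let (p , h′) = Equivalence.to (T-∧ {not (hull d t x)}) h
               (q , w) = Equivalence.to (T-∧ {not (hull d t y)}) h′ in
           T-not⁻ p , T-not⁻ q , Equivalence.to (T-adjIn s) w)
    (λ (p , q , w) → Equivalence.from T-∧ (T-not⁺ p ,
           Equivalence.from (T-∧ {not (hull d t y)}) (T-not⁺ q , Equivalence.from (T-adjIn s) w)))

  T-component : ∀ d s t {v x} → T (component d s t v x) ⇔ Star (OffHull d s t) v x
  T-component d s t = mk⇔
    (λ h → mapStar (Equivalence.to (T-offHull d s t)) (Equivalence.to (T-reach (offHull d s t)) h))
    (λ h → Equivalence.from (T-reach (offHull d s t)) (mapStar (Equivalence.from (T-offHull d s t)) h))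

  hull-base : ∀ d t {x} → T (lookup t x) → T (hull d t x)
  hull-base d t x∈t = Equivalence.from (T-hull d t) (_ , x∈t , ε)

  hull-step : ∀ d t {x y} → T (hull d t x) → EdgeIn d x y → T (hull d t y)
  hull-step d t h e with Equivalence.to (T-hull d t) h
  ... | s , s∈t , r = Equivalence.from (T-hull d t) (s , s∈t , r ◅◅ e ◅ ε)

  conn-both : ∀ {ω i x y} → Star (EdgeIn (both ω)) x y → Conn ω (x , i) (y , i)
  conn-both {ω} {i} = gmap (_, i) λ (e , o , j) → hor i e (Equivalence.to (both⇔ {ω}) o i) j

  conn-vert : ∀ {ω x} i j → T (lookup (vert ω) x) → Conn ω (x , i) (x , j)
  conn-vert false false _ = ε
  conn-vert true  true  _ = ε
  conn-vert false true  x∈t = ver false x∈t ◅ ε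
  conn-vert true  false x∈t = ver true x∈t ◅ ε

  conn-hull : ∀ {ω x} i j → T (hull (both ω) (vert ω) x) → Conn ω (x , i) (x , j)
  conn-hull {ω} i j h with Equivalence.to (T-hull (both ω) (vert ω)) h
  ... | s , s∈t , r = conn-sym (conn-both {ω} r) ◅◅ conn-vert i j s∈t ◅◅ conn-both {ω} r

  module Component (ω : Config G) (v : V) where
    C : V → Bool
    C = component (both ω) (either ω) (vert ω) v

    T-C : ∀ {x} → T (C x) ⇔ Star (OffHull (both ω) (either ω) (vert ω)) v x
    T-C = T-component (both ω) (either ω) (vert ω)

    C-refl : T (C v)
    C-refl = Equivalence.from T-C ε

    C-off-hull : ¬ T (hull (both ω) (vert ω) v) → ∀ {x} → T (C x) → ¬ T (hull (both ω) (vert ω) x)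
    C-off-hull v∉ c = go v∉ (Equivalence.to T-C c)
      where
      go : ∀ {x y} → ¬ T (hull (both ω) (vert ω) x) → Star (OffHull (both ω) (either ω) (vert ω)) x y →
           ¬ T (hull (both ω) (vert ω) y)
      go x∉ ε = x∉
      go x∉ ((_ , y∉ , _) ◅ r) = go y∉ r

    -- An edge with an open copy whose far end is off the hull would extend the component, so the
    -- only way out of `C` is into the hull.
    C-step : ¬ T (hull (both ω) (vert ω) v) → ∀ {x y} → T (C x) → EdgeIn (either ω) x y →
      T (C y) ⊎ T (hull (both ω) (vert ω) y)
    C-step v∉ {x} {y} c e with T? (hull (both ω) (vert ω) y)
    ... | yes h = inj₂ h
    ... | no y∉ = inj₁ (Equivalence.from T-C
            (Equivalence.to T-C c ◅◅ (C-off-hull v∉ c , y∉ , e) ◅ ε))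

  touching : (V → Bool) → Vec Bool (m G)
  touching C = tabulate λ e → C (proj₁ (ends G e)) ∨ C (proj₂ (ends G e))

  T-touching : ∀ C {e x y} → Joins e x y → T (lookup (touching C) e) ⇔ (T (C x) ⊎ T (C y))
  T-touching C {e} j = subst (λ b → T b ⇔ _) (sym (lookup∘tabulate _ e))
    (mk⇔ (to (joins-ends j)) (from (joins-ends j)))
    where
    to : ∀ {x y} → ends G e ≡ (x , y) ⊎ ends G e ≡ (y , x) →
         T (C (proj₁ (ends G e)) ∨ C (proj₂ (ends G e))) → T (C x) ⊎ T (C y)
    to (inj₁ refl) h = Equivalence.to T-∨ h
    to (inj₂ refl) h = swap (Equivalence.to T-∨ h)
    from : ∀ {x y} → ends G e ≡ (x , y) ⊎ ends G e ≡ (y , x) →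
         T (C x) ⊎ T (C y) → T (C (proj₁ (ends G e)) ∨ C (proj₂ (ends G e)))
    from (inj₁ refl) h = Equivalence.from T-∨ h
    from (inj₂ refl) h = Equivalence.from T-∨ (swap h)

  swapped : Vec Bool (m G) → Config G → Config G
  swapped g (config h0 h1 t) = config (mix g h0 h1) (mix g h1 h0) t

  -- Edges with just one end in `C` are exchanged too, so that an open copy leaving `C` is again
  -- open at the flipped copy of its end in `C`.
  swapSet : V → Config G → Vec Bool (m G)
  swapSet v ω = touching (Component.C ω v)

  mirror : V → Config G → Config G
  mirror v ω = swapped (swapSet v ω) ω

  both-swapped : ∀ g ω → both (swapped g ω) ≡ both ω
  both-swapped g ω = zipWith-mix ∧-comm g (hor0 ω) (hor1 ω)

  either-swapped : ∀ g ω → either (swapped g ω) ≡ either ω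
  either-swapped g ω = zipWith-mix ∨-comm g (hor0 ω) (hor1 ω)

  swapped-involutive : ∀ g ω → swapped g (swapped g ω) ≡ ω
  swapped-involutive g (config h0 h1 t) =
    cong₂ (λ a b → config a b t) (mix-involutive g h0 h1) (mix-involutive g h1 h0)

  -- The component is built from `both`, `either` and the vertical edges, and the first two do not
  -- record which layer holds an open copy. So the set of exchanged edges survives every exchange,
  -- which makes `mirror` an involution and `E-swap` applicable.
  component-swapped : ∀ g ω v → Component.C (swapped g ω) v ≡ Component.C ω v
  component-swapped g ω v = cong₂ (λ d s → component d s (vert ω) v) (both-swapped g ω) (either-swapped g ω)

  swapSet-swapped : ∀ v g ω → swapSet v (swapped g ω) ≡ swapSet v ω
  swapSet-swapped v g ω = cong touching (component-swapped g ω v)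

  mirror-involutive : ∀ v ω → mirror v (mirror v ω) ≡ ω
  mirror-involutive v ω = trans
    (cong (λ g → swapped g (mirror v ω)) (swapSet-swapped v (swapSet v ω) ω))
    (swapped-involutive (swapSet v ω) ω)

  lookup-swapped-in : ∀ g ω i {e} → T (lookup g e) →
    lookup (horLayer (swapped g ω) (not i)) e ≡ lookup (horLayer ω i) e
  lookup-swapped-in g ω i {e} e∈g with Equivalence.to T-≡ e∈g
  lookup-swapped-in g ω false {e} _ | eq =
    trans (lookup-mix g (hor1 ω) (hor0 ω) e) (cong (if_then lookup (hor0 ω) e else lookup (hor1 ω) e) eq)
  lookup-swapped-in g ω true {e} _ | eq =
    trans (lookup-mix g (hor0 ω) (hor1 ω) e) (cong (if_then lookup (hor1 ω) e else lookup (hor0 ω) e) eq)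

  lookup-swapped-out : ∀ g ω i {e} → ¬ T (lookup g e) →
    lookup (horLayer (swapped g ω) i) e ≡ lookup (horLayer ω i) e
  lookup-swapped-out g ω i {e} e∉g with lookup g e in eq
  ... | true = ⊥-elim (e∉g _)
  lookup-swapped-out g ω false {e} e∉g | false =
    trans (lookup-mix g (hor0 ω) (hor1 ω) e) (cong (if_then lookup (hor1 ω) e else lookup (hor0 ω) e) eq)
  lookup-swapped-out g ω true {e} e∉g | false =
    trans (lookup-mix g (hor1 ω) (hor0 ω) e) (cong (if_then lookup (hor0 ω) e else lookup (hor1 ω) e) eq)

  module Mirror (v : V) where

    flip : Config G → BVertex G → BVertex G
    flip ω (x , i) = x , (if Component.C ω v x then not i else i)

    Hull : Config G → V → Set
    Hull ω x = T (hull (both ω) (vert ω) x)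

    hull-mirror : ∀ ω {x} → Hull (mirror v ω) x ≡ Hull ω x
    hull-mirror ω {x} = cong (λ d → T (hull d (vert ω) x)) (both-swapped (swapSet v ω) ω)

    flip-in : ∀ ω {x i} → T (Component.C ω v x) → flip ω (x , i) ≡ (x , not i)
    flip-in ω {x} c rewrite Equivalence.to T-≡ c = refl

    flip-out : ∀ ω {x i} → ¬ T (Component.C ω v x) → flip ω (x , i) ≡ (x , i)
    flip-out ω {x} c with Component.C ω v x
    ... | true  = ⊥-elim (c _)
    ... | false = refl

    private
      Conn′ : Config G → BVertex G → BVertex G → Set
      Conn′ ω = Conn (mirror v ω)

      transport : ∀ {ω a b a′ b′} → a′ ≡ a → b′ ≡ b → Conn′ ω a b → Conn′ ω a′ b′
      transport refl refl c = c

      -- An edge leaving the component ends in the hull, where the two layers are connected anyway.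
      crossing : ∀ {ω} → ¬ Hull ω v → ∀ {x y} i e → T (lookup (horLayer ω i) e) → Joins e x y →
        T (Component.C ω v x) → ¬ T (Component.C ω v y) → Conn′ ω (x , not i) (y , i)
      crossing {ω} v∉ {x} {y} i e o j x∈ y∉
        with Component.C-step ω v v∉ x∈ (e , Equivalence.from (either⇔ {ω}) (i , o) , j)
      ... | inj₁ y∈ = ⊥-elim (y∉ y∈)
      ... | inj₂ h =
        hor (not i) e (subst T (sym (lookup-swapped-in _ ω i (Equivalence.from (T-touching (Component.C ω v) j) (inj₁ x∈)))) o) j
        ◅ conn-hull (not i) i (subst (λ A → A) (sym (hull-mirror ω)) h)

      flip-step : ∀ {ω} → ¬ Hull ω v → ∀ {a b} → Open ω a b → Conn′ ω (flip ω a) (flip ω b)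
      flip-step {ω} v∉ (ver {x} i o) =
        -- An open vertical edge sits at a vertex of `t`, hence in the hull and off `C`, so `flip`
        -- fixes both of its ends.
        let x∉ = λ c → Component.C-off-hull ω v v∉ c (hull-base (both ω) (vert ω) o) in
        transport (flip-out ω x∉) (flip-out ω x∉) (conn-vert i (not i) o)
      flip-step {ω} v∉ (hor {x} {y} i e o j) with T? (Component.C ω v x) | T? (Component.C ω v y)
      ... | yes x∈ | yes y∈ = transport (flip-in ω x∈) (flip-in ω y∈)
              (hor (not i) e (subst T (sym (lookup-swapped-in _ ω i
                (Equivalence.from (T-touching (Component.C ω v) j) (inj₁ x∈)))) o) j ◅ ε)
      ... | yes x∈ | no y∉ = transport (flip-in ω x∈) (flip-out ω y∉) (crossing v∉ i e o j x∈ y∉)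
      ... | no x∉ | yes y∈ = transport (flip-out ω x∉) (flip-in ω y∈)
              (conn-sym (crossing v∉ i e o (joins-sym j) y∈ x∉))
      ... | no x∉ | no y∉ = transport (flip-out ω x∉) (flip-out ω y∉)
              (hor i e (subst T (sym (lookup-swapped-out _ ω i
                (λ w → [ x∉ , y∉ ]′ (Equivalence.to (T-touching (Component.C ω v) j) w)))) o) j ◅ ε)

    flip-conn : ∀ {ω} → ¬ Hull ω v → ∀ {a b} → Conn ω a b → Conn (mirror v ω) (flip ω a) (flip ω b)
    flip-conn {ω} v∉ = kleisliStar (flip ω) (flip-step v∉)

    -- Since `mirror` is an involution that keeps the component, the converse is `flip-conn` applied
    -- to the mirrored configuration.
    flip-conn⁻ : ∀ {ω} → ¬ Hull ω v → ∀ {a b} → Conn (mirror v ω) a b → Conn ω (flip ω a) (flip ω b)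
    flip-conn⁻ {ω} v∉ {a} {b} c =
      -- In `flipBy` the component is an argument, so the `flip` of the mirrored configuration can
      -- be rewritten into that of `ω`.
      subst₂ (λ ω′ C → Conn ω′ (flipBy C a) (flipBy C b)) (mirror-involutive v ω)
        (component-swapped (swapSet v ω) ω v)
        (flip-conn {mirror v ω} (λ h → v∉ (subst (λ A → A) (hull-mirror ω) h)) c)
      where
      flipBy : (V → Bool) → BVertex G → BVertex G
      flipBy C (x , i) = x , (if C x then not i else i)

T-ext : ∀ {a b} → (T a → T b) → (T b → T a) → a ≡ b
T-ext {false} {false} f g = refl
T-ext {false} {true}  f g = ⊥-elim (g _)
T-ext {true}  {false} f g = ⊥-elim (f _)
T-ext {true}  {true}  f g = refl

-- Inner and boundary edges of a vertex set

data Kind : Set where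
  inner boundary outer : Kind

kindOf : Bool → Bool → Kind
kindOf true  true  = inner
kindOf false false = outer
kindOf _     _     = boundary

-- Events are tested along a vector of edge kinds, so that their probabilities can be found by
-- recursion on this vector without reference to the graph.
allEdges anyEdge : (Kind → Bool → Bool → Bool) → ∀ {m} → Vec Kind m → Vec Bool m → Vec Bool m → Bool
allEdges f []       []       []       = true
allEdges f (k ∷ ks) (a ∷ as) (b ∷ bs) = f k a b ∧ allEdges f ks as bs
anyEdge f []       []       []       = false
anyEdge f (k ∷ ks) (a ∷ as) (b ∷ bs) = f k a b ∨ anyEdge f ks as bs

T-allEdges : ∀ f {m} (ks : Vec Kind m) as bs →
  T (allEdges f ks as bs) ⇔ (∀ e → T (f (lookup ks e) (lookup as e) (lookup bs e)))
T-allEdges f [] [] [] = mk⇔ (λ _ ()) _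
T-allEdges f (k ∷ ks) (a ∷ as) (b ∷ bs) = mk⇔
  (λ h → let (p , q) = Equivalence.to (T-∧ {f k a b}) h in
    λ { F.zero → p ; (F.suc e) → Equivalence.to (T-allEdges f ks as bs) q e })
  (λ h → Equivalence.from (T-∧ {f k a b})
    (h F.zero , Equivalence.from (T-allEdges f ks as bs) (h ∘ F.suc)))

T-anyEdge : ∀ f {m} (ks : Vec Kind m) as bs e → T (f (lookup ks e) (lookup as e) (lookup bs e)) →
  T (anyEdge f ks as bs)
T-anyEdge f (k ∷ ks) (a ∷ as) (b ∷ bs) F.zero    h = Equivalence.from T-∨ (inj₁ h)
T-anyEdge f (k ∷ ks) (a ∷ as) (b ∷ bs) (F.suc e) h =
  Equivalence.from (T-∨ {f k a b}) (inj₂ (T-anyEdge f ks as bs e h))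

-- In `sealed` a boundary edge is closed in layer 0 alone. This has probability `q`, comparable with
-- `1 - p * p` for `notDouble`; closing both copies would have probability only `q * q`.
notDouble only₀ only₁ sealed : Kind → Bool → Bool → Bool
notDouble boundary a b = not (a ∧ b)
notDouble _        a b = true
only₀ inner a b = a ∧ not b
only₀ _     a b = false
only₁ inner a b = not a ∧ b
only₁ _     a b = false
sealed inner    a b = a ∧ b
sealed boundary a b = not a
sealed outer    a b = true

mixed : ∀ {m} → Vec Kind m → Vec Bool m → Vec Bool m → Bool
mixed ks h0 h1 = allEdges notDouble ks h0 h1 ∧ (anyEdge only₀ ks h0 h1 ∧ anyEdge only₁ ks h0 h1)

module Kinds (G : Graph) (K : Vec Bool (n G)) where
  open Bunkbed G

  kinds : Vec Kind (m G)
  kinds = tabulate λ e → kindOf (lookup K (proj₁ (ends G e))) (lookup K (proj₂ (ends G e)))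

  private
    lookup-kinds : ∀ e → lookup kinds e ≡ kindOf (lookup K (proj₁ (ends G e))) (lookup K (proj₂ (ends G e)))
    lookup-kinds = lookup∘tabulate _

    kindOf-sym : ∀ a b → kindOf a b ≡ kindOf b a
    kindOf-sym false false = refl
    kindOf-sym false true  = refl
    kindOf-sym true  false = refl
    kindOf-sym true  true  = refl

  kind-joins : ∀ {e x y} → Joins e x y → lookup kinds e ≡ kindOf (lookup K x) (lookup K y)
  kind-joins {e} {x} {y} j with joins-ends {e} j
  ... | inj₁ eq = trans (lookup-kinds e) (cong (λ (a , b) → kindOf (lookup K a) (lookup K b)) eq)
  ... | inj₂ eq = trans (trans (lookup-kinds e) (cong (λ (a , b) → kindOf (lookup K a) (lookup K b)) eq))
                        (kindOf-sym (lookup K y) (lookup K x))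

  kind-inner : ∀ {e x y} → Joins e x y → T (lookup K x) → T (lookup K y) → lookup kinds e ≡ inner
  kind-inner j x∈ y∈ = trans (kind-joins j) (cong₂ kindOf (Equivalence.to T-≡ x∈) (Equivalence.to T-≡ y∈))

  kind-boundary : ∀ {e x y} → Joins e x y → T (lookup K x) → ¬ T (lookup K y) → lookup kinds e ≡ boundary
  kind-boundary {e} {x} {y} j x∈ y∉ with lookup K x | lookup K y | kind-joins j
  ... | true | false | eq = eq
  ... | true | true  | _  = ⊥-elim (y∉ _)

  kind-boundary⁻ : ∀ e → lookup kinds e ≡ boundary → ∃₂ λ x y → Joins e x y × T (lookup K x) × ¬ T (lookup K y)
  kind-boundary⁻ e eq with lookup K (proj₁ (ends G e)) in eq₁
                         | lookup K (proj₂ (ends G e)) in eq₂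
                         | trans (sym (lookup-kinds e)) eq
  ... | true  | false | _ = _ , _ , ends-joins e , Equivalence.from T-≡ eq₁ , λ h → subst T eq₂ h
  ... | false | true  | _ = _ , _ , joins-sym (ends-joins e) , Equivalence.from T-≡ eq₂ , λ h → subst T eq₁ h

-- Straight and crossed connections in a single configuration

module Comparison (G : Graph) (t : Subset (n G)) (u v : Fin (n G)) where
  open Bunkbed G
  open Mirror v
  open Kinds G using (kinds; kind-inner; kind-boundary; kind-boundary⁻)

  Same Cross : Config G → Set
  Same  ω = Conn ω (u , false) (v , false) × ¬ Conn ω (u , false) (v , true)
  Cross ω = Conn ω (u , false) (v , true) × ¬ Conn ω (u , false) (v , false)

  -- If `v` were in the hull, its two copies would be connected, and reaching one would mean
  -- reaching the other.
  cross-off-hull : ∀ {ω} → Cross ω → ¬ Hull ω v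
  cross-off-hull (c , nc) h = nc (c ◅◅ conn-hull true false h)

  same-off-hull : ∀ {ω} → Same ω → ¬ Hull ω v
  same-off-hull (c , nc) h = nc (c ◅◅ conn-hull false true h)

  private
    flipped : ∀ {ω a b a′ b′} → flip ω a ≡ a′ → flip ω b ≡ b′ → ¬ Hull ω v →
              Conn ω a b → Conn (mirror v ω) a′ b′
    flipped refl refl v∉ c = flip-conn v∉ c

    flipped⁻ : ∀ {ω a b a′ b′} → flip ω a ≡ a′ → flip ω b ≡ b′ → ¬ Hull ω v →
               Conn (mirror v ω) a b → Conn ω a′ b′
    flipped⁻ refl refl v∉ c = flip-conn⁻ v∉ c

  module _ {ω : Config G} where
    open Component ω v using (C; C-refl)

    -- If `u` is off the component, only the target changes layer. Otherwise both ends do, and the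
    -- straight connection comes from the one in layer 1; a crossed connection after mirroring would
    -- come from one between `(u , true)` and `(v , false)`, which with the two given connections
    -- would join `(u , false)` to `(v , false)`.
    cross-mirror : Cross ω → ¬ T (C u) ⊎ Conn ω (u , true) (v , true) → Same (mirror v ω)
    cross-mirror cr@(c , nc) (inj₁ u∉) =
      flipped (flip-out ω u∉) (flip-in ω C-refl) (cross-off-hull cr) c ,
      λ c′ → nc (flipped⁻ (flip-out ω u∉) (flip-in ω C-refl) (cross-off-hull cr) c′)
    cross-mirror cr@(c , nc) (inj₂ c₁) with T? (C u)
    ... | no u∉ = cross-mirror cr (inj₁ u∉)
    ... | yes u∈ =
      flipped (flip-in ω u∈) (flip-in ω C-refl) (cross-off-hull cr) c₁ ,
      λ c′ → nc (c ◅◅ conn-sym c₁ ◅◅ flipped⁻ (flip-in ω u∈) (flip-in ω C-refl) (cross-off-hull cr) c′)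

    -- The opposite direction, for the case of equality: with `u` off the component only the target
    -- changes layer.
    same-mirror : Same ω → ¬ T (C u) → Cross (mirror v ω)
    same-mirror sm@(c , nc) u∉ =
      flipped (flip-out ω u∉) (flip-in ω C-refl) (same-off-hull sm) c ,
      λ c′ → nc (flipped⁻ (flip-out ω u∉) (flip-in ω C-refl) (same-off-hull sm) c′)

  DoublyConn : Config G → Set
  DoublyConn ω = Star (EdgeIn (both ω)) v u

  -- Mirroring preserves `both`, so the images of cross configurations avoid the doubly connected
  -- ones, which are reserved for the sealed events.
  cross-not-doubly : ∀ {ω} → Cross ω → ¬ DoublyConn ω
  cross-not-doubly {ω} (c , nc) d = nc (conn-sym (conn-both {ω} d))

  Within : Vec Bool (n G) → V → V → Set
  Within K x y = T (lookup K x) × T (lookup K y) × ∃ λ e → Joins e x y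

  -- The vertex sets that can occur as the component of v when u belongs to it.
  record Valid (K : Vec Bool (n G)) : Set where
    constructor valid
    field
      u∈K       : T (lookup K u)
      v∈K       : T (lookup K v)
      off-t     : ∀ x → T (lookup K x) → ¬ T (lookup t x)
      connected-within : ∀ x → T (lookup K x) → Star (Within K) v x
  open Valid public

  within : Vec Bool (n G) → V → V → Bool
  within K x y = lookup K x ∧ lookup K y ∧ any (λ e → joins G e x y) (allFin (m G))

  T-within : ∀ K {x y} → T (within K x y) ⇔ Within K x y
  T-within K {x} {y} = mk⇔
    (λ h → let (p , h′) = Equivalence.to (T-∧ {lookup K x}) h
               (q , w) = Equivalence.to (T-∧ {lookup K y}) h′ in
           p , q , Equivalence.to (T-any (λ e → joins G e x y) ∈-allFin) w)
    (λ (p , q , w) → Equivalence.from (T-∧ {lookup K x}) (p , Equivalence.from (T-∧ {lookup K y})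
           (q , Equivalence.from (T-any (λ e → joins G e x y) ∈-allFin) w)))

  valid? : ∀ K → Dec (Valid K)
  valid? K = map′ (λ (a , b , c , d) → valid a b c d) (λ (valid a b c d) → a , b , c , d)
    (T? _ ×-dec T? _ ×-dec Fₚ.all? (λ x → T? _ →-dec ¬? (T? _))
      ×-dec Fₚ.all? (λ x → T? _ →-dec map′
        (λ h → mapStar (Equivalence.to (T-within K)) (Equivalence.to (T-reach (within K)) h))
        (λ r → Equivalence.from (T-reach (within K)) (mapStar (Equivalence.from (T-within K)) r))
        (T? (reach (within K) v x))))

  module _ {ω : Config G} (vert≡t : vert ω ≡ t) (cr : Cross ω) where
    open Component ω v

    private
      K : Vec Bool (n G)
      K = tabulate C

      K⇒C : ∀ {x} → T (lookup K x) → T (C x)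
      K⇒C {x} = subst T (lookup∘tabulate C x)

      C⇒K : ∀ {x} → T (C x) → T (lookup K x)
      C⇒K {x} = subst T (sym (lookup∘tabulate C x))

      v∉ : ¬ Hull ω v
      v∉ = cross-off-hull cr

      within-component : ∀ {x y} → T (C x) → Star (OffHull (both ω) (either ω) (vert ω)) x y → Star (Within K) x y
      within-component c ε = ε
      within-component c ((x∉ , y∉ , e , o , j) ◅ r) with C-step v∉ c (e , o , j)
      ... | inj₁ c′ = (C⇒K c , C⇒K c′ , e , j) ◅ within-component c′ r
      ... | inj₂ h  = ⊥-elim (y∉ h)

      -- A path in the component uses inner edges of `K` only, so it can be copied into a layer that
      -- contains every inner edge with an open copy.
      layer-path : ∀ i → (∀ e → lookup (kinds K) e ≡ inner → T (lookup (either ω) e) → T (lookup (horLayer ω i) e)) →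
        ∀ {x y} → T (C x) → Star (OffHull (both ω) (either ω) (vert ω)) x y → Conn ω (x , i) (y , i)
      layer-path i H c ε = ε
      layer-path i H c ((x∉ , y∉ , e , o , j) ◅ r) with C-step v∉ c (e , o , j)
      ... | inj₁ c′ = hor i e (H e (kind-inner K j (C⇒K c) (C⇒K c′)) o) j ◅ layer-path i H c′ r
      ... | inj₂ h  = ⊥-elim (y∉ h)

      T-∧-not : ∀ {a b} → T a → ¬ T b → T (a ∧ not b)
      T-∧-not {true} {false} _ _ = _
      T-∧-not {true} {true} _ h = h _

      T-not-∧ : ∀ {a b} → ¬ T a → T b → T (not a ∧ b)
      T-not-∧ {false} {true} _ _ = _
      T-not-∧ {true} {true} h _ = h _

    cross-valid : T (C u) → Valid K
    cross-valid u∈ = valid (C⇒K u∈) (C⇒K C-refl)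
      (λ x x∈ x∈t → C-off-hull v∉ (K⇒C x∈)
        (hull-base (both ω) (vert ω) (subst (λ s → T (lookup s x)) (sym vert≡t) x∈t)))
      (λ x x∈ → within-component C-refl (Equivalence.to T-C (K⇒C x∈)))

    -- If the singly open inner edges were all open in the same layer i, then u and v would be
    -- connected in layer i.
    cross-mixed : T (C u) → ¬ Conn ω (u , true) (v , true) → T (mixed (kinds K) (hor0 ω) (hor1 ω))
    cross-mixed u∈ nc₁ = Equivalence.from (T-∧ {allEdges notDouble (kinds K) (hor0 ω) (hor1 ω)})
      (Equivalence.from (T-allEdges notDouble (kinds K) (hor0 ω) (hor1 ω)) not-double ,
       Equivalence.from (T-∧ {anyEdge only₀ (kinds K) (hor0 ω) (hor1 ω)}) (some₀ , some₁))
      where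
      not-double : ∀ e → T (notDouble (lookup (kinds K) e) (lookup (hor0 ω) e) (lookup (hor1 ω) e))
      not-double e with lookup (kinds K) e in eq
      ... | inner = _
      ... | outer = _
      ... | boundary = T-not⁺ λ dbl → leave (kind-boundary⁻ K e eq)
              (Equivalence.to (T-∧ {lookup (hor0 ω) e}) dbl)
        where
        leave : (∃₂ λ x y → Joins e x y × T (lookup K x) × ¬ T (lookup K y)) →
                T (lookup (hor0 ω) e) × T (lookup (hor1 ω) e) → ⊥
        leave (x , y , j , x∈ , y∉) (o₀ , o₁)
          with C-step v∉ (K⇒C x∈) (e , Equivalence.from (either⇔ {ω}) (false , o₀) , j)
        ... | inj₁ y∈ = y∉ (C⇒K y∈)
        -- The far end is in the hull, and the edge is doubly open, so the near end would be in the
        -- hull as well.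
        ... | inj₂ h  = C-off-hull v∉ (K⇒C x∈)
                (hull-step (both ω) (vert ω) h (e , Equivalence.from (both⇔ {ω})
                  (λ { false → o₀ ; true → o₁ }) , joins-sym j))
      v⇝u : Star (OffHull (both ω) (either ω) (vert ω)) v u
      v⇝u = Equivalence.to T-C u∈
      some₀ : T (anyEdge only₀ (kinds K) (hor0 ω) (hor1 ω))
      some₀ with T? (anyEdge only₀ (kinds K) (hor0 ω) (hor1 ω))
      ... | yes h = h
      ... | no none = ⊥-elim (nc₁ (conn-sym (layer-path true in-layer C-refl v⇝u)))
        where
        in-layer : ∀ e → lookup (kinds K) e ≡ inner → T (lookup (either ω) e) → T (lookup (hor1 ω) e)
        in-layer e k o with T? (lookup (hor1 ω) e) | Equivalence.to (either⇔ {ω}) o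
        ... | yes o₁ | _ = o₁
        ... | no c₁ | true , o₁ = o₁
        ... | no c₁ | false , o₀ = ⊥-elim (none (T-anyEdge only₀ (kinds K) (hor0 ω) (hor1 ω) e
                (subst (λ k → T (only₀ k _ _)) (sym k) (T-∧-not o₀ c₁))))
      some₁ : T (anyEdge only₁ (kinds K) (hor0 ω) (hor1 ω))
      some₁ with T? (anyEdge only₁ (kinds K) (hor0 ω) (hor1 ω))
      ... | yes h = h
      ... | no none = ⊥-elim (proj₂ cr (conn-sym (layer-path false in-layer C-refl v⇝u)))
        where
        in-layer : ∀ e → lookup (kinds K) e ≡ inner → T (lookup (either ω) e) → T (lookup (hor0 ω) e)
        in-layer e k o with T? (lookup (hor0 ω) e) | Equivalence.to (either⇔ {ω}) o
        ... | yes o₀ | _ = o₀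
        ... | no c₀ | false , o₀ = o₀
        ... | no c₀ | true , o₁ = ⊥-elim (none (T-anyEdge only₁ (kinds K) (hor0 ω) (hor1 ω) e
                (subst (λ k → T (only₁ k _ _)) (sym k) (T-not-∧ c₀ o₁))))

  module _ {ω : Config G} (vert≡t : vert ω ≡ t) {K : Vec Bool (n G)} (K-valid : Valid K)
    (seal : T (allEdges sealed (kinds K) (hor0 ω) (hor1 ω))) where

    private
      sealed-at : ∀ {k} e → lookup (kinds K) e ≡ k → T (sealed k (lookup (hor0 ω) e) (lookup (hor1 ω) e))
      sealed-at e refl = Equivalence.to (T-allEdges sealed (kinds K) _ _) seal e

      inner-open : ∀ {x y} → Within K x y → EdgeIn (both ω) x y
      inner-open (x∈ , y∈ , e , j) = e , Equivalence.from (both⇔ {ω})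
        (let (p , q) = Equivalence.to (T-∧ {lookup (hor0 ω) e}) (sealed-at e (kind-inner K j x∈ y∈)) in
          λ { false → p ; true → q }) , j

      stays : ∀ {x y} e → T (lookup K x) → T (lookup (hor0 ω) e) → Joins e x y → T (lookup K y)
      stays {x} {y} e x∈ o j with T? (lookup K y)
      ... | yes y∈ = y∈
      ... | no y∉ = ⊥-elim (T-not⁻ (sealed-at e (kind-boundary K j x∈ y∉)) o)

      -- Boundary edges are closed in layer 0, and the vertical edges at `K` are closed because `K`
      -- avoids `t`; a path from layer 0 of `K` has no exit.
      cluster : ∀ {x b} → T (lookup K x) → Conn ω (x , false) b → T (lookup K (proj₁ b)) × proj₂ b ≡ false
      cluster x∈ ε = x∈ , refl
      cluster x∈ (hor .false e o j ◅ r) = cluster (stays e x∈ o j) r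
      cluster {x} x∈ (ver .false o ◅ r) =
        ⊥-elim (off-t K-valid x x∈ (subst (λ s → T (lookup s x)) vert≡t o))

    sealed-doubly : DoublyConn ω
    sealed-doubly = mapStar inner-open (connected-within K-valid u (u∈K K-valid))

    sealed-same : Same ω
    sealed-same = conn-sym (conn-both {ω} sealed-doubly) , λ c → absurd (proj₂ (cluster (u∈K K-valid) c))
      where
      absurd : true ≡ false → ⊥
      absurd ()

    -- The configuration determines `K`, as the cluster of `v` in layer 0. This makes the sealed
    -- events of different sets disjoint.
    sealed-cluster : K ≡ tabulate (reach (adjIn (hor0 ω)) v)
    sealed-cluster = trans (sym (tabulate∘lookup K)) (tabulate-cong λ x → T-ext
      (λ x∈ → Equivalence.from (T-reach (adjIn (hor0 ω))) (mapStar
        (λ w → let (e , o , j) = inner-open w in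
          Equivalence.from (T-adjIn (hor0 ω)) (e , Equivalence.to (both⇔ {ω}) o false , j))
        (connected-within K-valid x x∈)))
      (λ r → grow (v∈K K-valid) (Equivalence.to (T-reach (adjIn (hor0 ω))) r)))
      where
      grow : ∀ {x y} → T (lookup K x) → Star (λ a b → T (adjIn (hor0 ω) a b)) x y → T (lookup K y)
      grow x∈ ε = x∈
      grow x∈ (h ◅ r) = let (e , o , j) = Equivalence.to (T-adjIn (hor0 ω)) h in grow (stays e x∈ o j) r

  Induced : V → V → Set
  Induced x y = ¬ T (lookup t x) × ¬ T (lookup t y) × ∃ λ e → Joins e x y

  T-inducedAdj : ∀ {x y} → T (inducedAdj G t x y) ⇔ Induced x y
  T-inducedAdj {x} {y} = mk⇔
    (λ h → let (p , h′) = Equivalence.to (T-∧ {outside t x}) h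
               (q , w) = Equivalence.to (T-∧ {outside t y}) h′ in
           T-not⁻ p , T-not⁻ q , Equivalence.to (T-any (λ e → joins G e x y) ∈-allFin) w)
    (λ (p , q , w) → Equivalence.from (T-∧ {outside t x}) (T-not⁺ p , Equivalence.from (T-∧ {outside t y})
           (T-not⁺ q , Equivalence.from (T-any (λ e → joins G e x y) ∈-allFin) w)))

  T-connectedInduced : T (connectedInduced G t u v) ⇔ (¬ T (lookup t u) × ¬ T (lookup t v) × Star Induced u v)
  T-connectedInduced = mk⇔
    (λ h → let (p , h′) = Equivalence.to (T-∧ {outside t u}) h
               (q , w) = Equivalence.to (T-∧ {outside t v}) h′ in
           T-not⁻ p , T-not⁻ q ,
           mapStar (Equivalence.to T-inducedAdj) (Equivalence.to (T-reach (inducedAdj G t)) w))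
    (λ (p , q , w) → Equivalence.from (T-∧ {outside t u}) (T-not⁺ p , Equivalence.from (T-∧ {outside t v})
           (T-not⁺ q , Equivalence.from (T-reach (inducedAdj G t)) (mapStar (Equivalence.from T-inducedAdj) w))))

  -- Provides a set for which the comparison of mixed and sealed is strict: the component of `v` in
  -- the subgraph induced by the complement of `t`.
  induced-valid : T (connectedInduced G t u v) → ∃ Valid
  induced-valid h = K , valid (C⇒K (reverse sym-induced u⇝v)) (C⇒K ε)
    (λ x x∈ → off (K⇒C x∈))
    (λ x x∈ → path ε (K⇒C x∈))
    where
    v∉t : ¬ T (lookup t v)
    v∉t = proj₁ (proj₂ (Equivalence.to T-connectedInduced h))
    u⇝v : Star Induced u v
    u⇝v = proj₂ (proj₂ (Equivalence.to T-connectedInduced h))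
    sym-induced : ∀ {x y} → Induced x y → Induced y x
    sym-induced (p , q , e , j) = q , p , e , joins-sym j
    K : Vec Bool (n G)
    K = tabulate (reach (inducedAdj G t) v)
    K⇒C : ∀ {x} → T (lookup K x) → Star Induced v x
    K⇒C {x} w = mapStar (Equivalence.to T-inducedAdj)
      (Equivalence.to (T-reach (inducedAdj G t)) (subst T (lookup∘tabulate _ x) w))
    C⇒K : ∀ {x} → Star Induced v x → T (lookup K x)
    C⇒K {x} r = subst T (sym (lookup∘tabulate _ x))
      (Equivalence.from (T-reach (inducedAdj G t)) (mapStar (Equivalence.from T-inducedAdj) r))
    off : ∀ {x} → Star Induced v x → ¬ T (lookup t x)
    off r = go v∉t r
      where
      go : ∀ {x y} → ¬ T (lookup t x) → Star Induced x y → ¬ T (lookup t y)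
      go x∉ ε = x∉
      go x∉ ((_ , y∉ , _) ◅ r) = go y∉ r
    -- The walk from `v` to the current vertex is carried along, because it witnesses that the
    -- vertex lies in `K`.
    path : ∀ {x y} → Star Induced v x → Star Induced x y → Star (Within K) x y
    path r ε = ε
    path r (s@(_ , _ , e , j) ◅ rs) = (C⇒K r , C⇒K (r ◅◅ s ◅ ε) , e , j) ◅ path (r ◅◅ s ◅ ε) rs

  -- The hull contains `t`, so a path in the component of `v` is a path in the induced subgraph.
  -- Hence `u` is off the component and `same-mirror` applies.
  same-separated : ∀ {ω} → vert ω ≡ t → ¬ T (connectedInduced G t u v) → Same ω → Cross (mirror v ω)
  same-separated {ω} refl nconn sm = same-mirror sm λ u∈ → nconn (Equivalence.from T-connectedInduced
    ( (λ u∈t → Component.C-off-hull ω v v∉ u∈ (hull-base (both ω) t u∈t))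
    , (λ v∈t → v∉ (hull-base (both ω) t v∈t))
    -- Each edge has already been turned around by `induced`; `reverse` with the identity only
    -- reverses their order.
    , reverse (λ w → w) (mapStar induced (Equivalence.to (Component.T-C ω v) u∈))))
    where
    v∉ : ¬ Hull ω v
    v∉ = same-off-hull sm
    induced : ∀ {x y} → OffHull (both ω) (either ω) t x y → Induced y x
    induced (x∉ , y∉ , e , _ , j) = (λ y∈t → y∉ (hull-base (both ω) t y∈t)) ,
      (λ x∈t → x∉ (hull-base (both ω) t x∈t)) , e , joins-sym j

-- Sums and expectations

0≤-+ : ∀ {a b} → 0ℚ ≤ a → 0ℚ ≤ b → 0ℚ ≤ a + b
0≤-+ {a} {b} ha hb = nonNegative⁻¹ (a + b)
  {{nonNeg+nonNeg⇒nonNeg a {{nonNegative ha}} b {{nonNegative hb}}}}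

0≤-* : ∀ {a b} → 0ℚ ≤ a → 0ℚ ≤ b → 0ℚ ≤ a * b
0≤-* {a} {b} ha hb = nonNegative⁻¹ (a * b)
  {{nonNeg*nonNeg⇒nonNeg a {{nonNegative ha}} b {{nonNegative hb}}}}

0<-* : ∀ {a b} → 0ℚ < a → 0ℚ < b → 0ℚ < a * b
0<-* {a} {b} ha hb = positive⁻¹ (a * b) {{pos*pos⇒pos a {{positive ha}} b {{positive hb}}}}

*-monoʳ-≤ : ∀ {r a b} → 0ℚ ≤ r → a ≤ b → r * a ≤ r * b
*-monoʳ-≤ {r} 0≤r = *-monoˡ-≤-nonNeg r {{nonNegative 0≤r}}

≤-by-difference : ∀ {a b} d → 0ℚ ≤ d → b ≡ a + d → a ≤ b
≤-by-difference {a} {b} d 0≤d b≡a+d = subst₂ _≤_ (+-identityʳ a) (sym b≡a+d) (+-monoʳ-≤ a 0≤d)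

0≤-square : ∀ r → 0ℚ ≤ r * r
0≤-square r with ≤-total 0ℚ r
... | inj₁ 0≤r = 0≤-* 0≤r 0≤r
... | inj₂ r≤0 = subst (0ℚ ≤_) (solve 1 (λ r → (con 0ℚ :- r) :* (con 0ℚ :- r) := r :* r) refl r)
        (0≤-* 0≤0-r 0≤0-r)
  where
  0≤0-r : 0ℚ ≤ 0ℚ - r
  0≤0-r = subst (0ℚ ≤_) (sym (+-identityˡ (- r))) (neg-antimono-≤ r≤0)

∑ : {A : Set} → List A → (A → ℚ) → ℚ
∑ []       f = 0ℚ
∑ (x ∷ xs) f = f x + ∑ xs f

ι : Bool → ℚ
ι b = if b then 1ℚ else 0ℚ

module _ {A : Set} where

  foldr≡∑ : ∀ (xs : List A) f → foldr (λ x s → f x + s) 0ℚ xs ≡ ∑ xs f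
  foldr≡∑ []       f = refl
  foldr≡∑ (x ∷ xs) f = cong (f x +_) (foldr≡∑ xs f)

  ∑-cong : ∀ (xs : List A) {f g} → (∀ x → f x ≡ g x) → ∑ xs f ≡ ∑ xs g
  ∑-cong []       f≡g = refl
  ∑-cong (x ∷ xs) f≡g = cong₂ _+_ (f≡g x) (∑-cong xs f≡g)

  ∑-mono : ∀ (xs : List A) {f g} → (∀ x → f x ≤ g x) → ∑ xs f ≤ ∑ xs g
  ∑-mono []       f≤g = ≤-refl
  ∑-mono (x ∷ xs) f≤g = +-mono-≤ (f≤g x) (∑-mono xs f≤g)

  ∑-0 : ∀ (xs : List A) → ∑ xs (λ _ → 0ℚ) ≡ 0ℚ
  ∑-0 []       = refl
  ∑-0 (x ∷ xs) = trans (+-identityˡ _) (∑-0 xs)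

  ∑-+ : ∀ (xs : List A) f g → ∑ xs (λ x → f x + g x) ≡ ∑ xs f + ∑ xs g
  ∑-+ []       f g = refl
  ∑-+ (x ∷ xs) f g = trans (cong ((f x + g x) +_) (∑-+ xs f g))
    (solve 4 (λ a b c d → (a :+ b) :+ (c :+ d) := (a :+ c) :+ (b :+ d)) refl (f x) (g x) (∑ xs f) (∑ xs g))

  ∑-* : ∀ (xs : List A) c f → ∑ xs (λ x → c * f x) ≡ c * ∑ xs f
  ∑-* []       c f = sym (*-zeroʳ c)
  ∑-* (x ∷ xs) c f = trans (cong ((c * f x) +_) (∑-* xs c f)) (sym (*-distribˡ-+ c (f x) (∑ xs f)))

  ∑-++ : ∀ (xs ys : List A) f → ∑ (xs ++ ys) f ≡ ∑ xs f + ∑ ys f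
  ∑-++ []       ys f = sym (+-identityˡ _)
  ∑-++ (x ∷ xs) ys f = trans (cong (f x +_) (∑-++ xs ys f)) (sym (+-assoc (f x) _ _))

  ∑-map : ∀ {B : Set} (h : B → A) xs f → ∑ (map h xs) f ≡ ∑ xs (λ x → f (h x))
  ∑-map h []       f = refl
  ∑-map h (x ∷ xs) f = cong (f (h x) +_) (∑-map h xs f)

  ∑-concatMap : ∀ {B : Set} (h : B → List A) xs f → ∑ (concatMap h xs) f ≡ ∑ xs (λ x → ∑ (h x) f)
  ∑-concatMap h []       f = refl
  ∑-concatMap h (x ∷ xs) f = trans (∑-++ (h x) (concatMap h xs) f) (cong (∑ (h x) f +_) (∑-concatMap h xs f))

∑-allVecs : ∀ k f → ∑ (allVecs (suc k)) f ≡ ∑ (allVecs k) (λ v → f (false ∷ v) + f (true ∷ v))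
∑-allVecs k f = trans (∑-concatMap _ (allVecs k) f)
  (∑-cong (allVecs k) λ v → cong (f (false ∷ v) +_) (+-identityʳ _))

vecEq-refl : ∀ {k} (v : Vec Bool k) → vecEq v v ≡ true
vecEq-refl []          = refl
vecEq-refl (false ∷ v) = vecEq-refl v
vecEq-refl (true  ∷ v) = vecEq-refl v

-- Serves to decompose by the value of a vector: the exchanged edges in `E-swap`, the vertical edges
-- in `Pbb-given`, the cluster in layer 0 in `good-bound`.
∑-pick : ∀ {k} (a : Vec Bool k) f → ∑ (allVecs k) (λ v → if vecEq v a then f v else 0ℚ) ≡ f a
∑-pick []      f = +-identityʳ _
∑-pick {suc k} (a ∷ as) f = trans (∑-allVecs k _) (step a)
  where
  step : ∀ a → ∑ (allVecs k) (λ v → (if vecEq (false ∷ v) (a ∷ as) then f (false ∷ v) else 0ℚ)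
                                  + (if vecEq (true ∷ v) (a ∷ as) then f (true ∷ v) else 0ℚ)) ≡ f (a ∷ as)
  step false = trans
    (∑-cong (allVecs k) λ v → +-identityʳ (if vecEq v as then f (false ∷ v) else 0ℚ))
    (∑-pick as (λ v → f (false ∷ v)))
  step true = trans
    (∑-cong (allVecs k) λ v → +-identityˡ (if vecEq v as then f (true ∷ v) else 0ℚ))
    (∑-pick as (λ v → f (true ∷ v)))

term≤∑ : ∀ {k} (a : Vec Bool k) {f} → (∀ v → 0ℚ ≤ f v) → f a ≤ ∑ (allVecs k) f
term≤∑ {k} a {f} 0≤f = subst (_≤ ∑ (allVecs k) f) (∑-pick a f) (∑-mono (allVecs k) bound)
  where
  bound : ∀ v → (if vecEq v a then f v else 0ℚ) ≤ f v
  bound v with vecEq v a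
  ... | true  = ≤-refl
  ... | false = 0≤f v

-- All gaps `g v - f v` are nonnegative, so their sum is at least the positive gap at `a`.
∑-strict : ∀ {k} (a : Vec Bool k) {f g} → (∀ v → f v ≤ g v) → f a < g a → ∑ (allVecs k) f < ∑ (allVecs k) g
∑-strict {k} a {f} {g} f≤g fa<ga = begin-strict
  ∑ (allVecs k) f                                     ≡⟨ +-identityʳ _ ⟨
  ∑ (allVecs k) f + 0ℚ                                <⟨ +-monoʳ-< (∑ (allVecs k) f) 0<gap ⟩
  ∑ (allVecs k) f + (g a - f a)                       ≤⟨ +-monoʳ-≤ (∑ (allVecs k) f) (term≤∑ a gap) ⟩
  ∑ (allVecs k) f + ∑ (allVecs k) (λ v → g v - f v)   ≡⟨ ∑-+ (allVecs k) f (λ v → g v - f v) ⟨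
  ∑ (allVecs k) (λ v → f v + (g v - f v))             ≡⟨ ∑-cong (allVecs k) (λ v →
      solve 2 (λ a b → a :+ (b :- a) := b) refl (f v) (g v)) ⟩
  ∑ (allVecs k) g                                     ∎
  where
  open ≤-Reasoning
  gap : ∀ v → 0ℚ ≤ g v - f v
  gap v = subst (_≤ g v - f v) (+-inverseʳ (f v)) (+-monoˡ-≤ (- f v) (f≤g v))
  0<gap : 0ℚ < g a - f a
  0<gap = subst (_< g a - f a) (+-inverseʳ (f a)) (+-monoˡ-< (- f a) fa<ga)

ι-mono : ∀ {a b} → (T a → T b) → ι a ≤ ι b
ι-mono {false} {false} h = ≤-refl
ι-mono {false} {true}  h = nonNegative⁻¹ 1ℚ
ι-mono {true}  {false} h = ⊥-elim (h _)
ι-mono {true}  {true}  h = ≤-refl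

0≤ι : ∀ b → 0ℚ ≤ ι b
0≤ι b = ι-mono {false} {b} λ ()

module Percolation (p : ℚ) where

  q : ℚ
  q = 1ℚ - p

  opaque
    -- Expectation over the states of the two copies of one edge.
    mean : (Bool → Bool → ℚ) → ℚ
    mean g = q * (q * g false false + p * g false true) + p * (q * g true false + p * g true true)

    mean-cong : ∀ {g h} → (∀ a b → g a b ≡ h a b) → mean g ≡ mean h
    mean-cong g≡h = cong₂ _+_
      (cong (q *_) (cong₂ _+_ (cong (q *_) (g≡h false false)) (cong (p *_) (g≡h false true))))
      (cong (p *_) (cong₂ _+_ (cong (q *_) (g≡h true false)) (cong (p *_) (g≡h true true))))

    mean-+ : ∀ g h → mean (λ a b → g a b + h a b) ≡ mean g + mean h
    mean-+ g h = solve 9 (λ p a b c d a′ b′ c′ d′ → let q = con 1ℚ :- p in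
        q :* (q :* (a :+ a′) :+ p :* (b :+ b′)) :+ p :* (q :* (c :+ c′) :+ p :* (d :+ d′))
        := (q :* (q :* a :+ p :* b) :+ p :* (q :* c :+ p :* d))
         :+ (q :* (q :* a′ :+ p :* b′) :+ p :* (q :* c′ :+ p :* d′))) refl
      p (g false false) (g false true) (g true false) (g true true)
      (h false false) (h false true) (h true false) (h true true)

    mean-const : ∀ c → mean (λ _ _ → c) ≡ c
    mean-const c = solve 2 (λ p c → let q = con 1ℚ :- p in
        q :* (q :* c :+ p :* c) :+ p :* (q :* c :+ p :* c) := c) refl p c

    mean-swap : ∀ g → mean (λ a b → g b a) ≡ mean g
    mean-swap g = solve 5 (λ p a b c d → let q = con 1ℚ :- p in
        q :* (q :* a :+ p :* c) :+ p :* (q :* b :+ p :* d)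
        := q :* (q :* a :+ p :* b) :+ p :* (q :* c :+ p :* d)) refl
      p (g false false) (g false true) (g true false) (g true true)

    mean-mono : 0ℚ ≤ p → 0ℚ ≤ q → ∀ {g h} → (∀ a b → g a b ≤ h a b) → mean g ≤ mean h
    mean-mono 0≤p 0≤q g≤h = +-mono-≤
      (*-monoʳ-≤ 0≤q (+-mono-≤ (*-monoʳ-≤ 0≤q (g≤h false false)) (*-monoʳ-≤ 0≤p (g≤h false true))))
      (*-monoʳ-≤ 0≤p (+-mono-≤ (*-monoʳ-≤ 0≤q (g≤h true false)) (*-monoʳ-≤ 0≤p (g≤h true true))))

    mean-unfold : ∀ g → mean g ≡
      q * (q * g false false + p * g false true) + p * (q * g true false + p * g true true)
    mean-unfold g = refl

  -- Both layers are read together, edge by edge, so that independence of the edges is built into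
  -- the recursion and exchanging the two copies of an edge is a symmetry of one `mean`.
  E : ∀ m → (Vec Bool m → Vec Bool m → ℚ) → ℚ
  E zero    f = f [] []
  E (suc m) f = mean λ a b → E m λ as bs → f (a ∷ as) (b ∷ bs)

  E-cong : ∀ m {f g : Vec Bool m → Vec Bool m → ℚ} → (∀ a b → f a b ≡ g a b) → E m f ≡ E m g
  E-cong zero    f≡g = f≡g [] []
  E-cong (suc m) f≡g = mean-cong λ a b → E-cong m λ as bs → f≡g (a ∷ as) (b ∷ bs)

  E-+ : ∀ m f g → E m (λ a b → f a b + g a b) ≡ E m f + E m g
  E-+ zero    f g = refl
  E-+ (suc m) f g = trans (mean-cong λ a b → E-+ m _ _) (mean-+ _ _)

  E-const : ∀ m c → E m (λ _ _ → c) ≡ c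
  E-const zero    c = refl
  E-const (suc m) c = trans (mean-cong λ _ _ → E-const m c) (mean-const c)

  E-∑ : ∀ m {A : Set} (xs : List A) (F : A → Vec Bool m → Vec Bool m → ℚ) →
    E m (λ a b → ∑ xs (λ x → F x a b)) ≡ ∑ xs (λ x → E m (F x))
  E-∑ m []       F = E-const m 0ℚ
  E-∑ m (x ∷ xs) F = trans (E-+ m (F x) _) (cong (E m (F x) +_) (E-∑ m xs F))

  -- The two copies of an edge are independent with the same law, so exchanging the copies on a
  -- fixed set of edges preserves the measure.
  E-mix : ∀ {m} (g : Vec Bool m) f → E m (λ a b → f (mix g a b) (mix g b a)) ≡ E m f
  E-mix []          f = refl
  E-mix (false ∷ g) f = mean-cong λ a b → E-mix g λ as bs → f (a ∷ as) (b ∷ bs)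
  E-mix {suc m} (true ∷ g) f = trans
    (mean-cong λ a b → E-mix g λ as bs → f (b ∷ as) (a ∷ bs))
    (mean-swap λ a b → E m λ as bs → f (a ∷ as) (b ∷ bs))

  -- The set of swapped edges may depend on the configuration, as long as swapping does not change it.
  E-swap : ∀ {m} (σ : Vec Bool m → Vec Bool m → Vec Bool m) →
    (∀ g a b → σ (mix g a b) (mix g b a) ≡ σ a b) → ∀ f →
    E m (λ a b → f (mix (σ a b) a b) (mix (σ a b) b a)) ≡ E m f
  E-swap {m} σ σ-inv f = begin
    E m (λ a b → f (mix (σ a b) a b) (mix (σ a b) b a))
      ≡⟨ E-cong m (λ a b → sym (∑-pick (σ a b) (λ g → f (mix g a b) (mix g b a)))) ⟩
    E m (λ a b → ∑ (allVecs m) (λ g → if vecEq g (σ a b) then f (mix g a b) (mix g b a) else 0ℚ))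
      ≡⟨ E-∑ m (allVecs m) _ ⟩
    ∑ (allVecs m) (λ g → E m (λ a b → if vecEq g (σ a b) then f (mix g a b) (mix g b a) else 0ℚ))
      -- For a fixed value `g`, invariance of `σ` lets the test be made after the exchange, and the
      -- exchange of the fixed set `g` is then removed by `E-mix`.
      ≡⟨ ∑-cong (allVecs m) (λ g → trans
           (E-cong m λ a b → cong (λ s → if vecEq g s then f (mix g a b) (mix g b a) else 0ℚ) (sym (σ-inv g a b)))
           (E-mix g (λ a b → if vecEq g (σ a b) then f a b else 0ℚ))) ⟩
    ∑ (allVecs m) (λ g → E m (λ a b → if vecEq g (σ a b) then f a b else 0ℚ))
      ≡⟨ E-∑ m (allVecs m) _ ⟨
    E m (λ a b → ∑ (allVecs m) (λ g → if vecEq g (σ a b) then f a b else 0ℚ))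
      ≡⟨ E-cong m (λ a b → ∑-pick (σ a b) (λ _ → f a b)) ⟩
    E m f ∎
    where open ≡-Reasoning

  private
    ∑∑ : ∀ m → (Vec Bool m → Vec Bool m → ℚ) → ℚ
    ∑∑ m F = ∑ (allVecs m) λ a → ∑ (allVecs m) λ b → F a b

    ∑∑-cong : ∀ m {F H} → (∀ a b → F a b ≡ H a b) → ∑∑ m F ≡ ∑∑ m H
    ∑∑-cong m F≡H = ∑-cong (allVecs m) λ a → ∑-cong (allVecs m) (F≡H a)

    ∑∑-+ : ∀ m F H → ∑∑ m (λ a b → F a b + H a b) ≡ ∑∑ m F + ∑∑ m H
    ∑∑-+ m F H = trans (∑-cong (allVecs m) λ a → ∑-+ (allVecs m) (F a) (H a)) (∑-+ (allVecs m) _ _)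

    ∑∑-* : ∀ m c F → ∑∑ m (λ a b → c * F a b) ≡ c * ∑∑ m F
    ∑∑-* m c F = trans (∑-cong (allVecs m) λ a → ∑-* (allVecs m) c (F a)) (∑-* (allVecs m) c _)

    ∑∑-suc : ∀ m F → ∑∑ (suc m) F ≡ ∑∑ m (λ a b →
      (F (false ∷ a) (false ∷ b) + F (false ∷ a) (true ∷ b)) + (F (true ∷ a) (false ∷ b) + F (true ∷ a) (true ∷ b)))
    ∑∑-suc m F = trans (∑-allVecs m _) (∑-cong (allVecs m) λ a → trans
      (cong₂ _+_ (∑-allVecs m (F (false ∷ a))) (∑-allVecs m (F (true ∷ a))))
      (sym (∑-+ (allVecs m) _ _)))

  E-weighted : ∀ m f → ∑∑ m (λ a b → vecWeight p a * vecWeight p b * f a b) ≡ E m f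
  E-weighted zero f = solve 1 (λ x → (con 1ℚ :* con 1ℚ :* x :+ con 0ℚ) :+ con 0ℚ := x) refl (f [] [])
  E-weighted (suc m) f = begin
    ∑∑ (suc m) (λ a b → vecWeight p a * vecWeight p b * f a b)
      ≡⟨ ∑∑-suc m _ ⟩
    ∑∑ m (λ a b → ((q * w a) * (q * w b) * f (false ∷ a) (false ∷ b) + (q * w a) * (p * w b) * f (false ∷ a) (true ∷ b))
                + ((p * w a) * (q * w b) * f (true ∷ a) (false ∷ b) + (p * w a) * (p * w b) * f (true ∷ a) (true ∷ b)))
      ≡⟨ ∑∑-cong m (λ a b → solve 7 (λ p x y A B C D → let q = con 1ℚ :- p in
           ((q :* x) :* (q :* y) :* A :+ (q :* x) :* (p :* y) :* B)
             :+ ((p :* x) :* (q :* y) :* C :+ (p :* x) :* (p :* y) :* D)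
           := q :* (q :* (x :* y :* A) :+ p :* (x :* y :* B)) :+ p :* (q :* (x :* y :* C) :+ p :* (x :* y :* D)))
           refl p (w a) (w b) (f (false ∷ a) (false ∷ b)) (f (false ∷ a) (true ∷ b))
           (f (true ∷ a) (false ∷ b)) (f (true ∷ a) (true ∷ b))) ⟩
    ∑∑ m (λ a b → q * (q * F false false a b + p * F false true a b) + p * (q * F true false a b + p * F true true a b))
      ≡⟨ trans (∑∑-+ m _ _) (cong₂ _+_ (pull q (F false false) (F false true)) (pull p (F true false) (F true true))) ⟩
    q * (q * ∑∑ m (F false false) + p * ∑∑ m (F false true)) + p * (q * ∑∑ m (F true false) + p * ∑∑ m (F true true))
      ≡⟨ mean-unfold (λ x y → ∑∑ m (F x y)) ⟨
    mean (λ x y → ∑∑ m (F x y))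
      ≡⟨ mean-cong (λ x y → E-weighted m (λ a b → f (x ∷ a) (y ∷ b))) ⟩
    mean (λ x y → E m (λ a b → f (x ∷ a) (y ∷ b))) ∎
    where
    open ≡-Reasoning
    w : ∀ {k} → Vec Bool k → ℚ
    w = vecWeight p
    F : Bool → Bool → Vec Bool m → Vec Bool m → ℚ
    F x y a b = w a * w b * f (x ∷ a) (y ∷ b)
    pull : ∀ c H H′ → ∑∑ m (λ a b → c * (q * H a b + p * H′ a b)) ≡ c * (q * ∑∑ m H + p * ∑∑ m H′)
    pull c H H′ = trans (∑∑-* m c _) (cong (c *_) (trans (∑∑-+ m _ _) (cong₂ _+_ (∑∑-* m q H) (∑∑-* m p H′))))

  -- Fixing the vertical edges contributes the constant factor `vecWeight p t`; given `t`, only the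
  -- expectation over the horizontal edges has to be compared.
  Pbb-given : ∀ G (A : Event G) t →
    Pbb G p (λ ω → A ω ∧ TEq G t ω) ≡ vecWeight p t * E (m G) (λ a b → ι (A (config a b t)))
  Pbb-given G A t = begin
    Pbb G p (λ ω → A ω ∧ TEq G t ω)
      ≡⟨ foldr≡∑ (allConfigs G) F ⟩
    ∑ (allConfigs G) F
      ≡⟨ ∑-concatMap _ (allVecs (m G)) F ⟩
    ∑ (allVecs (m G)) (λ a → ∑ (concatMap (λ b → map (config a b) (allVecs (n G))) (allVecs (m G))) F)
      ≡⟨ ∑-cong (allVecs (m G)) (λ a → ∑-concatMap _ (allVecs (m G)) F) ⟩
    ∑∑ (m G) (λ a b → ∑ (map (config a b) (allVecs (n G))) F)
      ≡⟨ ∑∑-cong (m G) (λ a b → ∑-map (config a b) (allVecs (n G)) F) ⟩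
    ∑∑ (m G) (λ a b → ∑ (allVecs (n G)) (λ s → F (config a b s)))
      ≡⟨ ∑∑-cong (m G) (λ a b → ∑-cong (allVecs (n G)) (λ s →
           if-∧ (A (config a b s)) (vecEq s t) (weight p {G} (config a b s)))) ⟩
    ∑∑ (m G) (λ a b → ∑ (allVecs (n G)) (λ s →
      if vecEq s t then (if A (config a b s) then weight p {G} (config a b s) else 0ℚ) else 0ℚ))
      ≡⟨ ∑∑-cong (m G) (λ a b → ∑-pick t _) ⟩
    ∑∑ (m G) (λ a b → if A (config a b t) then weight p {G} (config a b t) else 0ℚ)
      ≡⟨ ∑∑-cong (m G) (λ a b → if-ι (A (config a b t)) (vecWeight p a) (vecWeight p b) (vecWeight p t)) ⟩
    ∑∑ (m G) (λ a b → vecWeight p t * (vecWeight p a * vecWeight p b * ι (A (config a b t))))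
      ≡⟨ ∑∑-* (m G) (vecWeight p t) _ ⟩
    vecWeight p t * ∑∑ (m G) (λ a b → vecWeight p a * vecWeight p b * ι (A (config a b t)))
      ≡⟨ cong (vecWeight p t *_) (E-weighted (m G) _) ⟩
    vecWeight p t * E (m G) (λ a b → ι (A (config a b t))) ∎
    where
    open ≡-Reasoning
    F : Config G → ℚ
    F ω = if A ω ∧ TEq G t ω then weight p ω else 0ℚ
    if-∧ : ∀ x y c → (if x ∧ y then c else 0ℚ) ≡ (if y then (if x then c else 0ℚ) else 0ℚ)
    if-∧ false false c = refl
    if-∧ false true  c = refl
    if-∧ true  false c = refl
    if-∧ true  true  c = refl
    if-ι : ∀ x c d e → (if x then c * d * e else 0ℚ) ≡ e * (c * d * ι x)
    if-ι false c d e = solve 3 (λ c d e → con 0ℚ := e :* (c :* d :* con 0ℚ)) refl c d e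
    if-ι true  c d e = solve 3 (λ c d e → c :* d :* e := e :* (c :* d :* con 1ℚ)) refl c d e

  module Monotone (0≤p : 0ℚ ≤ p) (0≤q : 0ℚ ≤ q) where

    E-mono : ∀ m {f g : Vec Bool m → Vec Bool m → ℚ} → (∀ a b → f a b ≤ g a b) → E m f ≤ E m g
    E-mono zero    f≤g = f≤g [] []
    E-mono (suc m) f≤g = mean-mono 0≤p 0≤q λ a b → E-mono m λ as bs → f≤g (a ∷ as) (b ∷ bs)

    P : ∀ {m} → (Vec Bool m → Vec Bool m → Bool) → ℚ
    P {m} A = E m λ a b → ι (A a b)

    P-mono : ∀ {m} {A B : Vec Bool m → Vec Bool m → Bool} → (∀ a b → T (A a b) → T (B a b)) → P A ≤ P B
    P-mono {m} A⊆B = E-mono m λ a b → ι-mono (A⊆B a b)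

-- Probabilities of mixed and sealed sets

0≤difference : ∀ {a b} → a ≤ b → 0ℚ ≤ b - a
0≤difference {a} {b} a≤b = subst (_≤ b - a) (+-inverseʳ a) (+-monoˡ-≤ (- a) a≤b)

/1-+ : ∀ a b → (ℤ.+ (a ℕ.+ b)) / 1 ≡ (ℤ.+ a) / 1 + (ℤ.+ b) / 1
/1-+ a b = toℚᵘ-injective (begin
  toℚᵘ ((ℤ.+ (a ℕ.+ b)) / 1)                      ≈⟨ toℚᵘ-fromℚᵘ (ℚᵘ.mkℚᵘ (ℤ.+ (a ℕ.+ b)) 0) ⟩
  ℚᵘ.mkℚᵘ (ℤ.+ (a ℕ.+ b)) 0                       ≈⟨ ℚᵘ.*≡* (cong (ℤ._* (ℤ.+ 1)) (cong₂ ℤ._+_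
                                                       (sym (ℤₚ.*-identityʳ (ℤ.+ a))) (sym (ℤₚ.*-identityʳ (ℤ.+ b))))) ⟩
  ℚᵘ.mkℚᵘ (ℤ.+ a) 0 ℚᵘ.+ ℚᵘ.mkℚᵘ (ℤ.+ b) 0        ≈⟨ ℚᵘₚ.+-cong (toℚᵘ-fromℚᵘ (ℚᵘ.mkℚᵘ (ℤ.+ a) 0))
                                                       (toℚᵘ-fromℚᵘ (ℚᵘ.mkℚᵘ (ℤ.+ b) 0)) ⟨
  toℚᵘ ((ℤ.+ a) / 1) ℚᵘ.+ toℚᵘ ((ℤ.+ b) / 1)      ≈⟨ toℚᵘ-homo-+ ((ℤ.+ a) / 1) ((ℤ.+ b) / 1) ⟨
  toℚᵘ ((ℤ.+ a) / 1 + (ℤ.+ b) / 1)                ∎)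
  where open ℚᵘₚ.≃-Reasoning

2ℚ 4ℚ 16ℚ : ℚ
2ℚ  = (ℤ.+ 2) / 1
4ℚ  = (ℤ.+ 4) / 1
16ℚ = (ℤ.+ 16) / 1

-- For `0 < q`, the inequality `q * q * pow m ≤ 1ℚ` is the square of `q ≤ 2^(-m/2-2)`, stated
-- without the possibly irrational root.
pow : ℕ → ℚ
pow m = (ℤ.+ (2 ℕ.^ (m ℕ.+ 4))) / 1

pow-suc : ∀ m → pow (suc m) ≡ pow m + pow m
pow-suc m = trans (cong (λ k → (ℤ.+ (2 ℕ.^ (m ℕ.+ 4) ℕ.+ k)) / 1) (ℕₚ.+-identityʳ (2 ℕ.^ (m ℕ.+ 4))))
  (/1-+ (2 ℕ.^ (m ℕ.+ 4)) (2 ℕ.^ (m ℕ.+ 4)))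

0≤pow : ∀ m → 0ℚ ≤ pow m
0≤pow zero    = nonNegative⁻¹ (pow 0)
0≤pow (suc m) = subst (0ℚ ≤_) (sym (pow-suc m)) (0≤-+ (0≤pow m) (0≤pow m))

-- A boundary edge is not double with probability 1 - p² ≤ 2q; W collects the factors 2.
J W : ∀ {m} → Vec Kind m → ℚ
J []              = 0ℚ
J (inner    ∷ ks) = J ks + 1ℚ
J (boundary ∷ ks) = J ks
J (outer    ∷ ks) = J ks
W []              = 1ℚ
W (inner    ∷ ks) = W ks
W (boundary ∷ ks) = W ks + W ks
W (outer    ∷ ks) = W ks

0≤1 : 0ℚ ≤ 1ℚ
0≤1 = nonNegative⁻¹ 1ℚ

0≤J : ∀ {m} (ks : Vec Kind m) → 0ℚ ≤ J ks
0≤J []              = ≤-refl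
0≤J (inner    ∷ ks) = 0≤-+ (0≤J ks) 0≤1
0≤J (boundary ∷ ks) = 0≤J ks
0≤J (outer    ∷ ks) = 0≤J ks

1≤W : ∀ {m} (ks : Vec Kind m) → 1ℚ ≤ W ks
1≤W []              = ≤-refl
1≤W (inner    ∷ ks) = 1≤W ks
1≤W (boundary ∷ ks) = ≤-trans (1≤W ks) (≤-by-difference (W ks) (≤-trans 0≤1 (1≤W ks)) refl)
1≤W (outer    ∷ ks) = 1≤W ks

0≤W : ∀ {m} (ks : Vec Kind m) → 0ℚ ≤ W ks
0≤W ks = ≤-trans 0≤1 (1≤W ks)

pow-mono : ∀ m → pow m ≤ pow (suc m)
pow-mono m = ≤-by-difference (pow m) (0≤pow m) (pow-suc m)

-- With `j` inner and `b` boundary edges, `j + b ≤ m`, this is `j + 1 ≤ 2^j` multiplied by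
-- `16 * 2^b`.
linear≤pow : ∀ {m} (ks : Vec Kind m) → 16ℚ * ((J ks + 1ℚ) * W ks) ≤ pow m
linear≤pow [] = ≤-refl
linear≤pow {suc m} (inner ∷ ks) = begin
  16ℚ * ((J ks + 1ℚ + 1ℚ) * W ks)                                ≤⟨ ≤-by-difference (16ℚ * (J ks * W ks))
    (0≤-* (nonNegative⁻¹ 16ℚ) (0≤-* (0≤J ks) (0≤W ks))) (solve 2 (λ j w →
      con 16ℚ :* ((j :+ con 1ℚ) :* w) :+ con 16ℚ :* ((j :+ con 1ℚ) :* w)
      := con 16ℚ :* ((j :+ con 1ℚ :+ con 1ℚ) :* w) :+ con 16ℚ :* (j :* w)) refl (J ks) (W ks)) ⟩
  16ℚ * ((J ks + 1ℚ) * W ks) + 16ℚ * ((J ks + 1ℚ) * W ks)        ≤⟨ +-mono-≤ (linear≤pow ks) (linear≤pow ks) ⟩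
  pow m + pow m                                                  ≡⟨ pow-suc m ⟨
  pow (suc m)                                                    ∎
  where open ≤-Reasoning
linear≤pow {suc m} (boundary ∷ ks) = begin
  16ℚ * ((J ks + 1ℚ) * (W ks + W ks))                            ≡⟨ solve 2 (λ j w →
      con 16ℚ :* ((j :+ con 1ℚ) :* (w :+ w))
      := con 16ℚ :* ((j :+ con 1ℚ) :* w) :+ con 16ℚ :* ((j :+ con 1ℚ) :* w)) refl (J ks) (W ks) ⟩
  16ℚ * ((J ks + 1ℚ) * W ks) + 16ℚ * ((J ks + 1ℚ) * W ks)        ≤⟨ +-mono-≤ (linear≤pow ks) (linear≤pow ks) ⟩
  pow m + pow m                                                  ≡⟨ pow-suc m ⟨
  pow (suc m)                                                    ∎
  where open ≤-Reasoning
linear≤pow {suc m} (outer ∷ ks) = ≤-trans (linear≤pow ks) (pow-mono m)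

-- In the same notation this is `j^2 + j ≤ 2 * 2^j`. The left side grows by `2 * (j + 1)` with each
-- inner edge, a growth bounded by `linear≤pow`.
quadratic≤pow : ∀ {m} (ks : Vec Kind m) → 16ℚ * ((J ks * J ks + J ks) * W ks) ≤ pow m + pow m
quadratic≤pow [] = nonNegative⁻¹ (pow 0 + pow 0)
quadratic≤pow {suc m} (inner ∷ ks) = begin
  16ℚ * (((J ks + 1ℚ) * (J ks + 1ℚ) + (J ks + 1ℚ)) * W ks)       ≡⟨ solve 2 (λ j w →
      con 16ℚ :* (((j :+ con 1ℚ) :* (j :+ con 1ℚ) :+ (j :+ con 1ℚ)) :* w)
      := con 16ℚ :* ((j :* j :+ j) :* w) :+
         (con 16ℚ :* ((j :+ con 1ℚ) :* w) :+ con 16ℚ :* ((j :+ con 1ℚ) :* w))) refl (J ks) (W ks) ⟩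
  16ℚ * ((J ks * J ks + J ks) * W ks) + (16ℚ * ((J ks + 1ℚ) * W ks) + 16ℚ * ((J ks + 1ℚ) * W ks))
    ≤⟨ +-mono-≤ (quadratic≤pow ks) (+-mono-≤ (linear≤pow ks) (linear≤pow ks)) ⟩
  (pow m + pow m) + (pow m + pow m)                              ≡⟨ cong₂ _+_ (pow-suc m) (pow-suc m) ⟨
  pow (suc m) + pow (suc m)                                      ∎
  where open ≤-Reasoning
quadratic≤pow {suc m} (boundary ∷ ks) = begin
  16ℚ * ((J ks * J ks + J ks) * (W ks + W ks))                   ≡⟨ solve 2 (λ j w →
      con 16ℚ :* ((j :* j :+ j) :* (w :+ w))
      := con 16ℚ :* ((j :* j :+ j) :* w) :+ con 16ℚ :* ((j :* j :+ j) :* w)) refl (J ks) (W ks) ⟩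
  16ℚ * ((J ks * J ks + J ks) * W ks) + 16ℚ * ((J ks * J ks + J ks) * W ks)
    ≤⟨ +-mono-≤ (quadratic≤pow ks) (quadratic≤pow ks) ⟩
  (pow m + pow m) + (pow m + pow m)                              ≡⟨ cong₂ _+_ (pow-suc m) (pow-suc m) ⟨
  pow (suc m) + pow (suc m)                                      ∎
  where open ≤-Reasoning
quadratic≤pow {suc m} (outer ∷ ks) = ≤-trans (quadratic≤pow ks) (+-mono-≤ (pow-mono m) (pow-mono m))

module Bounds (p : ℚ) (0≤p : 0ℚ ≤ p) (0<q : 0ℚ < 1ℚ - p) where
  open Percolation p
  0≤q : 0ℚ ≤ q
  0≤q = <⇒≤ 0<q
  open Monotone 0≤p 0≤q

  -- The probability that all boundary edges are closed in layer 0, the common factor of the bounds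
  -- for mixed and sealed.
  Q : ∀ {m} → Vec Kind m → ℚ
  Q []              = 1ℚ
  Q (inner    ∷ ks) = Q ks
  Q (boundary ∷ ks) = q * Q ks
  Q (outer    ∷ ks) = Q ks

  0<Q : ∀ {m} (ks : Vec Kind m) → 0ℚ < Q ks
  0<Q []              = positive⁻¹ 1ℚ
  0<Q (inner    ∷ ks) = 0<Q ks
  0<Q (boundary ∷ ks) = 0<-* 0<q (0<Q ks)
  0<Q (outer    ∷ ks) = 0<Q ks

  0≤Q : ∀ {m} (ks : Vec Kind m) → 0ℚ ≤ Q ks
  0≤Q ks = <⇒≤ (0<Q ks)

  private
    split : ℚ → ℚ → ℚ → ℚ → ℚ
    split a b c d = q * (q * a + p * b) + p * (q * c + p * d)

    mean-≤ : ∀ {g a b c d} → g false false ≤ a → g false true ≤ b → g true false ≤ c → g true true ≤ d →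
      mean g ≤ split a b c d
    mean-≤ {g} ha hb hc hd = subst (_≤ _) (sym (mean-unfold g)) (+-mono-≤
      (*-monoʳ-≤ 0≤q (+-mono-≤ (*-monoʳ-≤ 0≤q ha) (*-monoʳ-≤ 0≤p hb)))
      (*-monoʳ-≤ 0≤p (+-mono-≤ (*-monoʳ-≤ 0≤q hc) (*-monoʳ-≤ 0≤p hd))))

    mean-≡ : ∀ {g a b c d} → g false false ≡ a → g false true ≡ b → g true false ≡ c → g true true ≡ d →
      mean g ≡ split a b c d
    mean-≡ {g} refl refl refl refl = mean-unfold g

    mean-const-≤ : ∀ {c d} → c ≤ d → mean (λ _ _ → c) ≤ d
    mean-const-≤ {c} c≤d = subst (_≤ _) (sym (mean-const c)) c≤d

    P-false : ∀ m → P {m} (λ _ _ → false) ≡ 0ℚ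
    P-false m = E-const m 0ℚ

    P-false-≤ : ∀ m → P {m} (λ _ _ → false) ≤ 0ℚ
    P-false-≤ m = ≤-reflexive (P-false m)

    -- An edge is not double with probability `1 - p^2 = 2q - q^2`; the term `q^2` is the slack.
    boundary-≤ : ∀ c {w z} → 0ℚ ≤ c → 0ℚ ≤ w → 0ℚ ≤ z →
      split (c * (w * z)) (c * (w * z)) (c * (w * z)) 0ℚ ≤ c * ((w + w) * (q * z))
    boundary-≤ c {w} {z} 0≤c 0≤w 0≤z = ≤-by-difference (q * q * (c * (w * z)))
      (0≤-* (0≤-* 0≤q 0≤q) (0≤-* 0≤c (0≤-* 0≤w 0≤z)))
      (solve 4 (λ p c w z → let q = con 1ℚ :- p ; y = c :* (w :* z) in
        c :* ((w :+ w) :* (q :* z))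
        := (q :* (q :* y :+ p :* y) :+ p :* (q :* y :+ p :* con 0ℚ)) :+ q :* q :* y) refl p c w z)

  private
    0≤x : ∀ {m} (ks : Vec Kind m) → 0ℚ ≤ W ks * Q ks
    0≤x ks = 0≤-* (0≤W ks) (0≤Q ks)

    0≤y : ∀ {m} (ks : Vec Kind m) → 0ℚ ≤ J ks * q * (W ks * Q ks)
    0≤y ks = 0≤-* (0≤-* (0≤J ks) 0≤q) (0≤x ks)

    0≤z : ∀ {m} (ks : Vec Kind m) → 0ℚ ≤ J ks * J ks * (q * q) * (W ks * Q ks)
    0≤z ks = 0≤-* (0≤-* (0≤-* (0≤J ks) (0≤J ks)) (0≤-* 0≤q 0≤q)) (0≤x ks)

  P-notDouble : ∀ {m} (ks : Vec Kind m) → P (allEdges notDouble ks) ≤ W ks * Q ks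
  P-notDouble [] = ≤-refl
  P-notDouble {suc m} (inner ∷ ks) = mean-const-≤ (P-notDouble ks)
  P-notDouble {suc m} (boundary ∷ ks) = subst₂ _≤_ refl (*-identityˡ _) (≤-trans
    (mean-≤ bound bound bound (P-false-≤ m)) (boundary-≤ 1ℚ 0≤1 (0≤W ks) (0≤Q ks)))
    where
    bound : P (allEdges notDouble ks) ≤ 1ℚ * (W ks * Q ks)
    bound = subst (P (allEdges notDouble ks) ≤_) (sym (*-identityˡ _)) (P-notDouble ks)
  P-notDouble {suc m} (outer ∷ ks) = mean-const-≤ (P-notDouble ks)

  -- A union bound over the inner edge open in layer 0 only, which has probability `p * q ≤ q`.
  P-only₀ : ∀ {m} (ks : Vec Kind m) →
    P (λ a b → allEdges notDouble ks a b ∧ anyEdge only₀ ks a b) ≤ J ks * q * (W ks * Q ks)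
  P-only₀ [] = ≤-reflexive (solve 1 (λ p → con 0ℚ := con 0ℚ :* (con 1ℚ :- p) :* (con 1ℚ :* con 1ℚ)) refl p)
  P-only₀ {suc m} (inner ∷ ks) = ≤-trans
    (mean-≤ (P-only₀ ks) (P-only₀ ks)
      -- Here the first edge itself is open in layer 0 only, so just the condition on the boundary
      -- is left.
      (≤-trans (P-mono λ a b h → proj₁ (Equivalence.to (T-∧ {allEdges notDouble ks a b}) h)) (P-notDouble ks))
      (P-only₀ ks))
    (≤-by-difference (p * q * (J ks * q * (W ks * Q ks)) + q * q * (W ks * Q ks))
      (0≤-+ (0≤-* (0≤-* 0≤p 0≤q) (0≤y ks)) (0≤-* (0≤-* 0≤q 0≤q) (0≤x ks)))
      (solve 3 (λ p j x → let q = con 1ℚ :- p ; y = j :* q :* x in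
        (j :+ con 1ℚ) :* q :* x
        := (q :* (q :* y :+ p :* y) :+ p :* (q :* x :+ p :* y)) :+ (p :* q :* y :+ q :* q :* x))
        refl p (J ks) (W ks * Q ks)))
  P-only₀ {suc m} (boundary ∷ ks) = ≤-trans
    (mean-≤ (P-only₀ ks) (P-only₀ ks) (P-only₀ ks) (P-false-≤ m))
    (boundary-≤ (J ks * q) (0≤-* (0≤J ks) 0≤q) (0≤W ks) (0≤Q ks))
  P-only₀ {suc m} (outer ∷ ks) = mean-const-≤ (P-only₀ ks)

  P-only₁ : ∀ {m} (ks : Vec Kind m) →
    P (λ a b → allEdges notDouble ks a b ∧ anyEdge only₁ ks a b) ≤ J ks * q * (W ks * Q ks)
  P-only₁ [] = ≤-reflexive (solve 1 (λ p → con 0ℚ := con 0ℚ :* (con 1ℚ :- p) :* (con 1ℚ :* con 1ℚ)) refl p)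
  P-only₁ {suc m} (inner ∷ ks) = ≤-trans
    (mean-≤ (P-only₁ ks)
      (≤-trans (P-mono λ a b h → proj₁ (Equivalence.to (T-∧ {allEdges notDouble ks a b}) h)) (P-notDouble ks))
      (P-only₁ ks) (P-only₁ ks))
    (≤-by-difference (p * q * (J ks * q * (W ks * Q ks)) + q * q * (W ks * Q ks))
      (0≤-+ (0≤-* (0≤-* 0≤p 0≤q) (0≤y ks)) (0≤-* (0≤-* 0≤q 0≤q) (0≤x ks)))
      (solve 3 (λ p j x → let q = con 1ℚ :- p ; y = j :* q :* x in
        (j :+ con 1ℚ) :* q :* x
        := (q :* (q :* y :+ p :* x) :+ p :* (q :* y :+ p :* y)) :+ (p :* q :* y :+ q :* q :* x))
        refl p (J ks) (W ks * Q ks)))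
  P-only₁ {suc m} (boundary ∷ ks) = ≤-trans
    (mean-≤ (P-only₁ ks) (P-only₁ ks) (P-only₁ ks) (P-false-≤ m))
    (boundary-≤ (J ks * q) (0≤-* (0≤J ks) 0≤q) (0≤W ks) (0≤Q ks))
  P-only₁ {suc m} (outer ∷ ks) = mean-const-≤ (P-only₁ ks)

  -- A union bound over pairs of inner edges, one open in layer 0 only and the other in layer 1
  -- only. There are at most `J ks * J ks` pairs, each of probability at most `q * q`.
  P-mixed : ∀ {m} (ks : Vec Kind m) → P (mixed ks) ≤ J ks * J ks * (q * q) * (W ks * Q ks)
  P-mixed [] = ≤-reflexive (solve 1 (λ p → let q = con 1ℚ :- p in
    con 0ℚ := con 0ℚ :* con 0ℚ :* (q :* q) :* (con 1ℚ :* con 1ℚ)) refl p)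
  P-mixed {suc m} (inner ∷ ks) = ≤-trans
    -- The state open in layer 1 only leaves the demand for an `only₀` edge, the state open in layer
    -- 0 only that for an `only₁` edge; the other two states leave both.
    (mean-≤ (P-mixed ks) (≤-trans (P-mono drop-true) (P-only₀ ks)) (P-only₁ ks) (P-mixed ks))
    (≤-by-difference (2ℚ * (p * q) * (J ks * J ks * (q * q) * (W ks * Q ks))
        + 2ℚ * (q * q) * (J ks * q * (W ks * Q ks)) + q * q * (W ks * Q ks))
      (0≤-+ (0≤-+ (0≤-* (0≤-* (nonNegative⁻¹ 2ℚ) (0≤-* 0≤p 0≤q)) (0≤z ks))
                  (0≤-* (0≤-* (nonNegative⁻¹ 2ℚ) (0≤-* 0≤q 0≤q)) (0≤y ks)))
            (0≤-* (0≤-* 0≤q 0≤q) (0≤x ks)))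
      (solve 3 (λ p j x → let q = con 1ℚ :- p ; y = j :* q :* x ; z = j :* j :* (q :* q) :* x in
        (j :+ con 1ℚ) :* (j :+ con 1ℚ) :* (q :* q) :* x
        := (q :* (q :* z :+ p :* y) :+ p :* (q :* y :+ p :* z))
           :+ (con 2ℚ :* (p :* q) :* z :+ con 2ℚ :* (q :* q) :* y :+ q :* q :* x))
        refl p (J ks) (W ks * Q ks)))
    where
    drop-true : ∀ a b → T (allEdges notDouble ks a b ∧ (anyEdge only₀ ks a b ∧ true)) →
      T (allEdges notDouble ks a b ∧ anyEdge only₀ ks a b)
    drop-true a b h = let (h₁ , h₂) = Equivalence.to (T-∧ {allEdges notDouble ks a b}) h in
      Equivalence.from (T-∧ {allEdges notDouble ks a b})
        (h₁ , proj₁ (Equivalence.to (T-∧ {anyEdge only₀ ks a b}) h₂))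
  P-mixed {suc m} (boundary ∷ ks) = ≤-trans
    (mean-≤ (P-mixed ks) (P-mixed ks) (P-mixed ks) (P-false-≤ m))
    (boundary-≤ (J ks * J ks * (q * q)) (0≤-* (0≤-* (0≤J ks) (0≤J ks)) (0≤-* 0≤q 0≤q)) (0≤W ks) (0≤Q ks))
  P-mixed {suc m} (outer ∷ ks) = mean-const-≤ (P-mixed ks)

  private
    P-sealed-inner : ∀ {m} (ks : Vec Kind m) → P (allEdges sealed (inner ∷ ks)) ≡ p * p * P (allEdges sealed ks)
    P-sealed-inner {m} ks = trans (mean-≡ (P-false m) (P-false m) (P-false m) refl)
      (solve 2 (λ p s → let q = con 1ℚ :- p in
        q :* (q :* con 0ℚ :+ p :* con 0ℚ) :+ p :* (q :* con 0ℚ :+ p :* s) := p :* p :* s) refl p _)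

    P-sealed-boundary : ∀ {m} (ks : Vec Kind m) → P (allEdges sealed (boundary ∷ ks)) ≡ q * P (allEdges sealed ks)
    P-sealed-boundary {m} ks = trans (mean-≡ refl refl (P-false m) (P-false m))
      (solve 2 (λ p s → let q = con 1ℚ :- p in
        q :* (q :* s :+ p :* s) :+ p :* (q :* con 0ℚ :+ p :* con 0ℚ) := q :* s) refl p _)

  P-sealed≤Q : ∀ {m} (ks : Vec Kind m) → P (allEdges sealed ks) ≤ Q ks
  P-sealed≤Q [] = ≤-refl
  P-sealed≤Q (inner ∷ ks) = subst (_≤ Q ks) (sym (P-sealed-inner ks)) (≤-trans
    (*-monoʳ-≤ (0≤-* 0≤p 0≤p) (P-sealed≤Q ks))
    (≤-by-difference (q * (1ℚ + p) * Q ks) (0≤-* (0≤-* 0≤q (0≤-+ 0≤1 0≤p)) (0≤Q ks))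
      (solve 2 (λ p x → x := p :* p :* x :+ (con 1ℚ :- p) :* (con 1ℚ :+ p) :* x) refl p (Q ks))))
  P-sealed≤Q (boundary ∷ ks) = subst (_≤ q * Q ks) (sym (P-sealed-boundary ks)) (*-monoʳ-≤ 0≤q (P-sealed≤Q ks))
  P-sealed≤Q (outer ∷ ks) = mean-const-≤ (P-sealed≤Q ks)

  -- The probability is `p^(2j) * Q ks` with `j` inner edges, and this is Bernoulli's inequality for
  -- `(1 - q)^(2j)`.
  P-sealed : ∀ {m} (ks : Vec Kind m) → Q ks - 2ℚ * (J ks * q * Q ks) ≤ P (allEdges sealed ks)
  P-sealed [] = ≤-reflexive (solve 1 (λ p → con 1ℚ :- con 2ℚ :* (con 0ℚ :* (con 1ℚ :- p) :* con 1ℚ) := con 1ℚ) refl p)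
  P-sealed (inner ∷ ks) = ≤-by-difference
    -- From `p * p = 1 - q * (1 + p)` and `q * (1 + p) = 2q - q * q`: the three terms are the slack
    -- of the induction hypothesis, that of `P-sealed≤Q`, and the remainder `q * q`.
    ((S - (Q ks - 2ℚ * (J ks * q * Q ks))) + q * (1ℚ + p) * (Q ks - S) + q * q * Q ks)
    (0≤-+ (0≤-+ (0≤difference (P-sealed ks)) (0≤-* (0≤-* 0≤q (0≤-+ 0≤1 0≤p)) (0≤difference (P-sealed≤Q ks))))
          (0≤-* (0≤-* 0≤q 0≤q) (0≤Q ks)))
    (trans (P-sealed-inner ks) (solve 4 (λ p j x s → let q = con 1ℚ :- p in
      p :* p :* s := (x :- con 2ℚ :* ((j :+ con 1ℚ) :* q :* x))
        :+ ((s :- (x :- con 2ℚ :* (j :* q :* x))) :+ q :* (con 1ℚ :+ p) :* (x :- s) :+ q :* q :* x))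
      refl p (J ks) (Q ks) S))
    where
    S : ℚ
    S = P (allEdges sealed ks)
  P-sealed (boundary ∷ ks) = subst₂ _≤_
    (solve 3 (λ p j x → let q = con 1ℚ :- p in
      q :* (x :- con 2ℚ :* (j :* q :* x)) := q :* x :- con 2ℚ :* (j :* q :* (q :* x))) refl p (J ks) (Q ks))
    (sym (P-sealed-boundary ks)) (*-monoʳ-≤ 0≤q (P-sealed ks))
  P-sealed (outer ∷ ks) = subst (Q ks - 2ℚ * (J ks * q * Q ks) ≤_) (sym (mean-const _)) (P-sealed ks)

  module _ {m} (q-small : q * q * pow m ≤ 1ℚ) (ks : Vec Kind m) where
    private
      j w x S Z : ℚ
      j = J ks
      w = W ks
      x = Q ks
      S = P (allEdges sealed ks)
      Z = P (mixed ks)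

      -- With `P-mixed` this bounds the mixed event by `Q ks / 8`.
      quadratic : 16ℚ * (j * j * w * (q * q)) ≤ 2ℚ
      quadratic = begin
        16ℚ * (j * j * w * (q * q))            ≤⟨ ≤-by-difference (16ℚ * (j * w * (q * q)))
          (0≤-* (nonNegative⁻¹ 16ℚ) (0≤-* (0≤-* (0≤J ks) (0≤W ks)) (0≤-* 0≤q 0≤q)))
          (solve 3 (λ p j w → let q = con 1ℚ :- p in
            q :* q :* (con 16ℚ :* ((j :* j :+ j) :* w))
            := con 16ℚ :* (j :* j :* w :* (q :* q)) :+ con 16ℚ :* (j :* w :* (q :* q))) refl p j w) ⟩
        q * q * (16ℚ * ((j * j + j) * w))      ≤⟨ *-monoʳ-≤ (0≤-* 0≤q 0≤q) (quadratic≤pow ks) ⟩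
        q * q * (pow m + pow m)                ≡⟨ *-distribˡ-+ (q * q) (pow m) (pow m) ⟩
        q * q * pow m + q * q * pow m          ≤⟨ +-mono-≤ q-small q-small ⟩
        2ℚ                                     ∎
        where open ≤-Reasoning

      -- Put `r = j * q`. Then `16r ≤ 4 + 16r^2` by completing the square, and `16r^2 ≤ 2` by
      -- `quadratic`, because `1 ≤ w`.
      linear : 16ℚ * (j * q) ≤ 4ℚ + 2ℚ
      linear = begin
        16ℚ * (j * q)                          ≤⟨ ≤-by-difference (4ℚ * ((2ℚ * (j * q) - 1ℚ) * (2ℚ * (j * q) - 1ℚ)))
          (0≤-* (nonNegative⁻¹ 4ℚ) (0≤-square (2ℚ * (j * q) - 1ℚ)))
          (solve 1 (λ r → con 4ℚ :+ con 16ℚ :* (r :* r)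
            := con 16ℚ :* r :+ con 4ℚ :* ((con 2ℚ :* r :- con 1ℚ) :* (con 2ℚ :* r :- con 1ℚ))) refl (j * q)) ⟩
        4ℚ + 16ℚ * (j * q * (j * q))           ≤⟨ +-monoʳ-≤ 4ℚ (≤-by-difference {16ℚ * (j * q * (j * q))}
          (16ℚ * (j * j * (q * q) * (w - 1ℚ)))
          (0≤-* (nonNegative⁻¹ 16ℚ) (0≤-* (0≤-* (0≤-* (0≤J ks) (0≤J ks)) (0≤-* 0≤q 0≤q)) (0≤difference (1≤W ks))))
          (solve 3 (λ q j w → con 16ℚ :* (j :* j :* w :* (q :* q))
            := con 16ℚ :* (j :* q :* (j :* q)) :+ con 16ℚ :* (j :* j :* (q :* q) :* (w :- con 1ℚ))) refl q j w)) ⟩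
        4ℚ + 16ℚ * (j * j * w * (q * q))       ≤⟨ +-monoʳ-≤ 4ℚ quadratic ⟩
        4ℚ + 2ℚ                                ∎
        where open ≤-Reasoning

    -- The mixed event has probability at most `x / 8`. By `linear`, `2 * j * q ≤ 3/4`, so the
    -- sealed event has probability at least `x / 4`.
    P-mixed<P-sealed : P (mixed ks) < P (allEdges sealed ks)
    P-mixed<P-sealed = *-cancelˡ-<-nonNeg 16ℚ (begin-strict
      16ℚ * Z                                            ≤⟨ *-monoʳ-≤ (nonNegative⁻¹ 16ℚ) (P-mixed ks) ⟩
      16ℚ * (j * j * (q * q) * (w * x))                  ≡⟨ solve 4 (λ q j w x →
        con 16ℚ :* (j :* j :* (q :* q) :* (w :* x)) := x :* (con 16ℚ :* (j :* j :* w :* (q :* q)))) refl q j w x ⟩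
      x * (16ℚ * (j * j * w * (q * q)))                  ≤⟨ *-monoʳ-≤ (0≤Q ks) quadratic ⟩
      x * 2ℚ                                             ≡⟨ +-identityʳ (x * 2ℚ) ⟨
      x * 2ℚ + 0ℚ                                        <⟨ +-monoʳ-< (x * 2ℚ) (0<-* (0<Q ks) (positive⁻¹ 2ℚ)) ⟩
      x * 2ℚ + x * 2ℚ                                    ≤⟨ ≤-by-difference
        (2ℚ * (x * (4ℚ + 2ℚ - 16ℚ * (j * q))))
        (0≤-* (nonNegative⁻¹ 2ℚ) (0≤-* (0≤Q ks) (0≤difference linear)))
        (solve 3 (λ q j x → con 16ℚ :* (x :- con 2ℚ :* (j :* q :* x))
          := (x :* con 2ℚ :+ x :* con 2ℚ)
             :+ con 2ℚ :* (x :* (con 4ℚ :+ con 2ℚ :- con 16ℚ :* (j :* q)))) refl q j x) ⟩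
      16ℚ * (x - 2ℚ * (j * q * x))                       ≤⟨ *-monoʳ-≤ (nonNegative⁻¹ 16ℚ) (P-sealed ks) ⟩
      16ℚ * S                                            ∎)
      where open ≤-Reasoning

-- Conditional probabilities

<⇒≱ : ∀ {a b} → a < b → ¬ b ≤ a
<⇒≱ a<b b≤a = <-irrefl refl (<-≤-trans a<b b≤a)

ι-≤ : ∀ {b x} → 0ℚ ≤ x → (T b → 1ℚ ≤ x) → ι b ≤ x
ι-≤ {false} 0≤x _   = 0≤x
ι-≤ {true}  _   1≤x = 1≤x _

ι-split : ∀ a b → ι a ≡ ι (a ∧ not b) + ι (a ∧ b)
ι-split false b     = refl
ι-split true  false = refl
ι-split true  true  = refl

1≤ι : ∀ {b} → T b → 1ℚ ≤ ι b
1≤ι {true} _ = ≤-refl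

difference-≤ : ∀ {a b c d} → a + d ≡ b + c → c ≤ d → a ≤ b
difference-≤ {a} {b} {c} {d} eq c≤d = ≤-by-difference (d - c) (0≤difference c≤d) (begin
  b              ≡⟨ solve 2 (λ b c → b := b :+ c :- c) refl b c ⟩
  b + c - c      ≡⟨ cong (_- c) eq ⟨
  a + d - c      ≡⟨ +-assoc a d (- c) ⟩
  a + (d - c)    ∎)
  where open ≡-Reasoning

difference-< : ∀ {a b c d} → a + d ≡ b + c → c < d → a < b
difference-< {a} {b} {c} {d} eq c<d with b ≤? a
... | no  b≰a = ≰⇒> b≰a
... | yes b≤a = ⊥-elim (<⇒≱ c<d (difference-≤ (trans (+-comm d a) (trans eq (+-comm b c))) b≤a))

module _ (G : Graph) (p : ℚ) (B : Event G) (0<PB : 0ℚ < Pbb G p B) (A A′ : Event G) where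

  private
    PB≢0 : ¬ Pbb G p B ≡ 0ℚ
    PB≢0 eq = <-irrefl (sym eq) 0<PB

  condP-mono-≤ : Pbb G p (λ ω → A ω ∧ B ω) ≤ Pbb G p (λ ω → A′ ω ∧ B ω) → condP G p A B ≤ condP G p A′ B
  condP-mono-≤ h with Pbb G p B ≟ 0ℚ
  ... | yes eq = ⊥-elim (PB≢0 eq)
  ... | no  ne = *-monoʳ-≤-nonNeg (1/_ (Pbb G p B) {{≢-nonZero ne}})
          {{pos⇒nonNeg (1/_ (Pbb G p B) {{≢-nonZero ne}}) {{1/pos⇒pos (Pbb G p B) {{positive 0<PB}}}}}} h

  condP-mono-< : Pbb G p (λ ω → A ω ∧ B ω) < Pbb G p (λ ω → A′ ω ∧ B ω) → condP G p A B < condP G p A′ B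
  condP-mono-< h with Pbb G p B ≟ 0ℚ
  ... | yes eq = ⊥-elim (PB≢0 eq)
  ... | no  ne = *-monoˡ-<-pos (1/_ (Pbb G p B) {{≢-nonZero ne}})
          {{1/pos⇒pos (Pbb G p B) {{positive 0<PB}}}} h

16≤pow : ∀ m → 16ℚ ≤ pow m
16≤pow zero    = ≤-refl
16≤pow (suc m) = ≤-trans (16≤pow m) (pow-mono m)

0<vecWeight : ∀ {p} → 0ℚ < p → 0ℚ < 1ℚ - p → ∀ {k} (v : Vec Bool k) → 0ℚ < vecWeight p v
0<vecWeight 0<p 0<q []          = positive⁻¹ 1ℚ
0<vecWeight 0<p 0<q (true  ∷ v) = 0<-* 0<p (0<vecWeight 0<p 0<q v)
0<vecWeight 0<p 0<q (false ∷ v) = 0<-* 0<q (0<vecWeight 0<p 0<q v)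

-- Comparison of the expectations for a fixed set of open vertical edges

module Conditioned (G : Graph) (u v : Fin (n G)) (t : Subset (n G)) (p : ℚ)
  (q-small : (1ℚ - p) * (1ℚ - p) * pow (m G) ≤ 1ℚ) (p<1 : p < 1ℚ) where

  0<1-p : 0ℚ < 1ℚ - p
  0<1-p = subst (_< 1ℚ - p) (+-inverseʳ p) (+-monoˡ-< (- p) p<1)

  -- Positivity is implied by `q-small`: for `p ≤ 0` the factor `1 - p` is at least 1, and the left
  -- side would be at least 16.
  0<p : 0ℚ < p
  0<p with p ≤? 0ℚ
  ... | no  p≰0 = ≰⇒> p≰0
  ... | yes p≤0 = ⊥-elim (<⇒≱ 1<16 (begin
    16ℚ                               ≤⟨ 16≤pow (m G) ⟩
    pow (m G)                         ≤⟨ ≤-by-difference ((0ℚ - p) * (2ℚ + (0ℚ - p)) * pow (m G))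
        (0≤-* (0≤-* 0≤-p (0≤-+ (nonNegative⁻¹ 2ℚ) 0≤-p)) (0≤pow (m G)))
        (solve 2 (λ p x → (con 1ℚ :- p) :* (con 1ℚ :- p) :* x
          := x :+ (con 0ℚ :- p) :* (con 2ℚ :+ (con 0ℚ :- p)) :* x) refl p (pow (m G))) ⟩
    (1ℚ - p) * (1ℚ - p) * pow (m G)   ≤⟨ q-small ⟩
    1ℚ                                ∎))
    where
    open ≤-Reasoning
    0≤-p : 0ℚ ≤ 0ℚ - p
    0≤-p = 0≤difference p≤0
    1<16 : 1ℚ < 16ℚ
    1<16 = from-yes (1ℚ <? 16ℚ)

  open Percolation p
  open Bounds p (<⇒≤ 0<p) 0<1-p
  open Monotone (<⇒≤ 0<p) (<⇒≤ 0<1-p)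
  open Bunkbed G
  open Comparison G t u v
  open Kinds G using (kinds)

  private
    cfg : Vec Bool (m G) → Vec Bool (m G) → Config G
    cfg a b = config a b t

    same cross doubly straight : Config G → Bool
    straight ω = connected G ω (u , false) (v , false)
    same   ω = straight ω ∧ not (connected G ω (u , false) (v , true))
    cross  ω = connected G ω (u , false) (v , true) ∧ not (straight ω)
    doubly ω = reach (adjIn (both ω)) v u

    T-∧-¬ : ∀ {a b} {A B : Set} → T a ⇔ A → T b ⇔ B → T (a ∧ not b) ⇔ (A × ¬ B)
    T-∧-¬ {a} a⇔A b⇔B = mk⇔
      (λ h → let (x , y) = Equivalence.to (T-∧ {a}) h in
        Equivalence.to a⇔A x , λ z → T-not⁻ y (Equivalence.from b⇔B z))
      (λ (x , y) → Equivalence.from (T-∧ {a})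
        (Equivalence.from a⇔A x , T-not⁺ λ z → y (Equivalence.to b⇔B z)))

    T-same : ∀ {ω} → T (same ω) ⇔ Same ω
    T-same = T-∧-¬ T-connected T-connected

    T-cross : ∀ {ω} → T (cross ω) ⇔ Cross ω
    T-cross = T-∧-¬ T-connected T-connected

    T-doubly : ∀ {ω} → T (doubly ω) ⇔ DoublyConn ω
    T-doubly {ω} = mk⇔
      (λ h → mapStar (Equivalence.to (T-adjIn (both ω))) (Equivalence.to (T-reach (adjIn (both ω))) h))
      (λ r → Equivalence.from (T-reach (adjIn (both ω))) (mapStar (Equivalence.from (T-adjIn (both ω))) r))

    validᵇ : Vec Bool (n G) → Bool
    validᵇ K = does (valid? K)

    Ks : _
    Ks = allVecs (n G)

    -- Both events are empty for an invalid `K`, so that sums can run over all vertex sets.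
    bad good : Vec Bool (n G) → Vec Bool (m G) → Vec Bool (m G) → Bool
    bad  K a b = validᵇ K ∧ mixed (kinds K) a b
    good K a b = validᵇ K ∧ allEdges sealed (kinds K) a b

    -- When `same` is split by double connection, this part receives the mirrored cross
    -- configurations and the other part contains the sealed events.
    rest : Vec Bool (m G) → Vec Bool (m G) → ℚ
    rest a b = ι (same (cfg a b) ∧ not (doubly (cfg a b)))

    mirrored : (Vec Bool (m G) → Vec Bool (m G) → ℚ) → Vec Bool (m G) → Vec Bool (m G) → ℚ
    mirrored f a b = f (mix (swapSet v (cfg a b)) a b) (mix (swapSet v (cfg a b)) b a)

    E-mirrored : ∀ f → E (m G) (mirrored f) ≡ E (m G) f
    E-mirrored = E-swap (λ a b → swapSet v (cfg a b)) (λ g a b → swapSet-swapped v g (cfg a b))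

    0≤∑bad : ∀ a b → 0ℚ ≤ ∑ Ks (λ K → ι (bad K a b))
    0≤∑bad a b = subst (_≤ ∑ Ks (λ K → ι (bad K a b))) (∑-0 Ks) (∑-mono Ks λ K → 0≤ι (bad K a b))

    -- Either the mirror image is counted by `rest`, or `u` lies in the component of `v` while
    -- `(u , true)` and `(v , true)` are not connected; then the component, as `tabulate C`, is a
    -- bad set.
    cross-bound : ∀ a b → ι (cross (cfg a b)) ≤ mirrored rest a b + ∑ Ks (λ K → ι (bad K a b))
    cross-bound a b = ι-≤ (0≤-+ 0≤rest (0≤∑bad a b)) λ h → go (Equivalence.to T-cross h)
      where
      ω : Config G
      ω = cfg a b
      open Component ω v using (C)
      0≤rest : 0ℚ ≤ mirrored rest a b
      0≤rest = 0≤ι (same (mirror v ω) ∧ not (doubly (mirror v ω)))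
      first : Cross ω → Same (mirror v ω) → 1ℚ ≤ mirrored rest a b + ∑ Ks (λ K → ι (bad K a b))
      first cr sm = ≤-trans
        (1≤ι {same (mirror v ω) ∧ not (doubly (mirror v ω))}
          (Equivalence.from (T-∧ {same (mirror v ω)}) (Equivalence.from T-same sm , T-not⁺ λ d →
          cross-not-doubly {ω} cr (subst (λ s → Star (EdgeIn s) v u) (both-swapped (swapSet v ω) ω)
            (Equivalence.to (T-doubly {mirror v ω}) d)))))
        (≤-by-difference _ (0≤∑bad a b) refl)
      go : Cross ω → 1ℚ ≤ mirrored rest a b + ∑ Ks (λ K → ι (bad K a b))
      go cr with T? (C u) | T? (connected G ω (u , true) (v , true))
      ... | no u∉  | _ = first cr (cross-mirror cr (inj₁ u∉))
      ... | yes u∈ | yes c = first cr (cross-mirror cr (inj₂ (Equivalence.to T-connected c)))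
      ... | yes u∈ | no nc = ≤-trans
        (1≤ι {bad (tabulate C) a b} (Equivalence.from (T-∧ {validᵇ (tabulate C)})
          (Equivalence.from (T-does (valid? (tabulate C))) (cross-valid refl cr u∈) ,
          cross-mixed refl cr u∈ (λ c → nc (Equivalence.from T-connected c)))))
        (≤-trans (term≤∑ (tabulate C) (λ K → 0≤ι (bad K a b)))
          (≤-by-difference (mirrored rest a b) 0≤rest (+-comm (mirrored rest a b) _)))

    -- By `sealed-cluster` the only term that can be nonzero is that of the layer 0 cluster `R`, so
    -- the sum collapses to one indicator.
    good-bound : ∀ a b → ∑ Ks (λ K → ι (good K a b)) ≤ ι (same (cfg a b) ∧ doubly (cfg a b))
    good-bound a b = subst (∑ Ks (λ K → ι (good K a b)) ≤_) (∑-pick R (λ _ → ι (same ω ∧ doubly ω)))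
      (∑-mono Ks bound)
      where
      ω : Config G
      ω = cfg a b
      R : Vec Bool (n G)
      R = tabulate (reach (adjIn a) v)
      bound : ∀ K → ι (good K a b) ≤ (if vecEq K R then ι (same ω ∧ doubly ω) else 0ℚ)
      bound K = ι-≤ nonneg λ h → let (val , seal) = Equivalence.to (T-∧ {validᵇ K} {allEdges sealed (kinds K) a b}) h in
        one (Equivalence.to (T-does (valid? K)) val) seal
        where
        nonneg : 0ℚ ≤ (if vecEq K R then ι (same ω ∧ doubly ω) else 0ℚ)
        nonneg with vecEq K R
        ... | true  = 0≤ι (same ω ∧ doubly ω)
        ... | false = ≤-refl
        one : Valid K → T (allEdges sealed (kinds K) a b) → 1ℚ ≤ (if vecEq K R then ι (same ω ∧ doubly ω) else 0ℚ)
        one val seal = subst (λ c → 1ℚ ≤ (if c then ι (same ω ∧ doubly ω) else 0ℚ))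
          (sym (trans (cong (λ L → vecEq L R) (sealed-cluster {ω} refl val seal)) (vecEq-refl R)))
          (1≤ι {same ω ∧ doubly ω} (Equivalence.from (T-∧ {same ω}) (Equivalence.from T-same (sealed-same {ω} refl val seal) ,
            Equivalence.from (T-doubly {ω}) (sealed-doubly {ω} refl val seal))))

    rest+good≤same : ∀ a b → rest a b + ∑ Ks (λ K → ι (good K a b)) ≤ ι (same (cfg a b))
    rest+good≤same a b = subst (rest a b + ∑ Ks (λ K → ι (good K a b)) ≤_)
      (sym (ι-split (same (cfg a b)) (doubly (cfg a b)))) (+-monoʳ-≤ (rest a b) (good-bound a b))

    Eι : Event G → ℚ
    Eι A = E (m G) λ a b → ι (A (cfg a b))

    E-cross-≤ : Eι cross ≤ E (m G) rest + ∑ Ks (λ K → P (bad K))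
    E-cross-≤ = begin
      Eι cross                                                             ≤⟨ E-mono (m G) cross-bound ⟩
      E (m G) (λ a b → mirrored rest a b + ∑ Ks (λ K → ι (bad K a b)))     ≡⟨ E-+ (m G) _ _ ⟩
      E (m G) (mirrored rest) + E (m G) (λ a b → ∑ Ks (λ K → ι (bad K a b))) ≡⟨ cong₂ _+_ (E-mirrored rest) (E-∑ (m G) Ks _) ⟩
      E (m G) rest + ∑ Ks (λ K → P (bad K))                                ∎
      where open ≤-Reasoning

    E-same-≥ : E (m G) rest + ∑ Ks (λ K → P (good K)) ≤ Eι same
    E-same-≥ = begin
      E (m G) rest + ∑ Ks (λ K → P (good K))                               ≡⟨ cong (E (m G) rest +_) (E-∑ (m G) Ks _) ⟨
      E (m G) rest + E (m G) (λ a b → ∑ Ks (λ K → ι (good K a b)))         ≡⟨ E-+ (m G) _ _ ⟨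
      E (m G) (λ a b → rest a b + ∑ Ks (λ K → ι (good K a b)))             ≤⟨ E-mono (m G) rest+good≤same ⟩
      Eι same                                                              ∎
      where open ≤-Reasoning

    bad≤good : ∀ K → P (bad K) ≤ P (good K)
    bad≤good K with validᵇ K
    ... | true  = <⇒≤ (P-mixed<P-sealed q-small (kinds K))
    ... | false = ≤-refl

    bad<good : ∀ K → Valid K → P (bad K) < P (good K)
    bad<good K val with validᵇ K | Equivalence.from (T-does (valid? K)) val
    ... | true | _ = P-mixed<P-sealed q-small (kinds K)

  E-cross≤E-same : Eι cross ≤ Eι same
  E-cross≤E-same = ≤-trans E-cross-≤ (≤-trans (+-monoʳ-≤ (E (m G) rest) (∑-mono Ks bad≤good)) E-same-≥)

  E-cross<E-same : T (connectedInduced G t u v) → Eι cross < Eι same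
  E-cross<E-same conn-uv = let (K , val) = induced-valid conn-uv in
    ≤-<-trans E-cross-≤ (<-≤-trans
      (+-monoʳ-< (E (m G) rest) (∑-strict K bad≤good (bad<good K val))) E-same-≥)

  -- Without a connection off `t`, the measure-preserving mirror map sends all of `same` into
  -- `cross`, which excludes strictness.
  E-same≤E-cross : ¬ T (connectedInduced G t u v) → Eι same ≤ Eι cross
  E-same≤E-cross separated = ≤-trans (E-mono (m G) λ a b → ι-mono λ h →
      Equivalence.from (T-cross {mirror v (cfg a b)}) (same-separated refl separated (Equivalence.to T-same h)))
    (≤-reflexive (E-mirrored λ a b → ι (cross (cfg a b))))

  -- Each side is the probability that at least one of the two targets is reached. Comparing the two
  -- connections thus amounts to comparing `cross` and `same`.
  E-balance : Eι (conn G (u , false) (v , true)) + Eι same ≡ Eι (conn G (u , false) (v , false)) + Eι cross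
  E-balance = trans (sym (E-+ (m G) _ _)) (trans
      (E-cong (m G) λ a b → balance (connected G (cfg a b) (u , false) (v , true)) (straight (cfg a b)))
      (E-+ (m G) _ _))
    where
    balance : ∀ x y → ι x + ι (y ∧ not x) ≡ ι y + ι (x ∧ not y)
    balance false false = refl
    balance false true  = refl
    balance true  false = refl
    balance true  true  = refl

  0<P-T : 0ℚ < Pbb G p (TEq G t)
  0<P-T = subst (0ℚ <_) (sym (trans (Pbb-given G (λ _ → true) t)
      (trans (cong (vecWeight p t *_) (E-const (m G) 1ℚ)) (*-identityʳ _))))
    (0<vecWeight 0<p 0<1-p t)

  condP-≤ : ∀ A A′ → Eι A ≤ Eι A′ → condP G p A (TEq G t) ≤ condP G p A′ (TEq G t)
  condP-≤ A A′ h = condP-mono-≤ G p (TEq G t) 0<P-T A A′ (subst₂ _≤_ (sym (Pbb-given G A t)) (sym (Pbb-given G A′ t))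
    (*-monoʳ-≤ (<⇒≤ (0<vecWeight 0<p 0<1-p t)) h))

  condP-< : ∀ A A′ → Eι A < Eι A′ → condP G p A (TEq G t) < condP G p A′ (TEq G t)
  condP-< A A′ h = condP-mono-< G p (TEq G t) 0<P-T A A′ (subst₂ _<_ (sym (Pbb-given G A t)) (sym (Pbb-given G A′ t))
    (*-monoʳ-<-pos (vecWeight p t) {{positive (0<vecWeight 0<p 0<1-p t)}} h))

open import Data.Nat using (_^_)
open import Data.Integer using (+_)

theorem2p1 : (G : Graph) (u v : Fin (n G)) (t : Subset (n G)) (p : ℚ) →
    (1ℚ - p) * (1ℚ - p) * ((+ (2 ^ (m G ℕ.+ 4))) / 1) ≤ 1ℚ →
    p < 1ℚ →
    (condP G p (conn G (u , false) (v , true)) (TEq G t)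
    ≤ condP G p (conn G (u , false) (v , false)) (TEq G t))
    × ((condP G p (conn G (u , false) (v , true)) (TEq G t)
    < condP G p (conn G (u , false) (v , false)) (TEq G t))
    ⇔ T (connectedInduced G t u v))
theorem2p1 G u v t p q-small p<1 =
  condP-≤ crossed straight (difference-≤ E-balance E-cross≤E-same) , mk⇔
    -- Connectedness off `t` is decidable, so it may be proved by contradiction: its failure would
    -- give the reverse weak inequality.
    (λ strict → decidable-stable (T? _) λ separated →
      <⇒≱ strict (condP-≤ straight crossed (difference-≤ (sym E-balance) (E-same≤E-cross separated))))
    (λ connected-uv → condP-< crossed straight (difference-< E-balance (E-cross<E-same connected-uv)))
  where
  open Conditioned G u v t p q-small p<1
  straight crossed : Event G
  straight = conn G (u , false) (v , false)
  crossed  = conn G (u , false) (v , true)
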